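{- Let $M$ be an algebraic number field of degree $m$ with ring of integers $\mathbb{Z}_M$ and integral basis $(1,\omega_2,\ldots,\omega_m)$. Let $\alpha$ be an algebraic integer over $M$ of degree $n$ over $M$, let $K=M(\alpha)$, and let $0\neq\mu\in\mathbb{Z}_M$. Define the constants $c_{hji}$, $c_{hi}$, $c_2$, $c_5$, $d_{hi}$ as follows: \[ c_{hji}=\tfrac12\left|\alpha^{(hj)}-\alpha^{(hi)}\right|\ (i\ne j),\qquad c_{hi}=\frac{|\mu^{(h)}|}{\prod_{1\le j\le n,\,j\ne i}c_{hji}},\qquad c_5=2c_2\,\overline{|\alpha|},\qquad d_{hi}=c_{hi}\,c_5^{\,n-1}, \] where $c_2$ is the row norm (maximum absolute row sum) of $S^{ -1}$, $S$ being the $m\times m$ matrix whose $j$-th row is $(1,\omega_2^{(j)},\ldots,\omega_m^{(j)})$. Fix indices $1\le h\le m$, $1\le i\le n$ and a constant $H>0$. Let $\mathcal{L}\subset\mathbb{R}^{2m+2}$ be the lattice generated by the $2m$ columns of the $(2m+2)\times 2m$ matrix whose first $2m$ rows form the $2m\times 2m$ identity matrix and whose last two rows are \[ \big(H\,\mathrm{Re}(1),\ H\,\mathrm{Re}(\omega_2^{(h)}),\ldots,H\,\mathrm{Re}(\omega_m^{(h)}),\ H\,\mathrm{Re}(\alpha^{(hi)}),\ H\,\mathrm{Re}(\alpha^{(hi)}\omega_2^{(h)}),\ldots,H\,\mathrm{Re}(\alpha^{(hi)}\omega_m^{(h)})\big), \] \[ \big(H\,\mathrm{Im}(1),\ H\,\mathrm{Im}(\omega_2^{(h)}),\ldots,H\,\mathrm{Im}(\omega_m^{(h)}),\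 H\,\mathrm{Im}(\alpha^{(hi)}),\ H\,\mathrm{Im}(\alpha^{(hi)}\omega_2^{(h)}),\ldots,H\,\mathrm{Im}(\alpha^{(hi)}\omega_m^{(h)})\big) \] (so the first entries of these two rows are $H$ and $0$). Let $b_1$ be the first vector of an LLL-reduced basis of $\mathcal{L}$. Assume that $x_1,\ldots,x_m,y_1,\ldots,y_m$ are integers, not all zero, with $A=\max(\max_k|x_k|,\max_k|y_k|)$, such that \[ \Big|x_1+\omega_2^{(h)}x_2+\cdots+\omega_m^{(h)}x_m-\alpha^{(hi)}y_1-\alpha^{(hi)}\omega_2^{(h)}y_2-\cdots-\alpha^{(hi)}\omega_m^{(h)}y_m\Big|\le d_{hi}\,A^{1-n}. \] If $A\le A_0$ for some constant $A_0>0$ and \[ |b_1|\ge\sqrt{(2m+1)\,2^{2m-1}}\cdot A_0, \] then \[ A\le\left(\frac{d_{hi}\,H}{A_0}\right)^{\frac{1}{n-1}}. \]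
   Context: Let $\sigma_1,\ldots,\sigma_m$ be the embeddings of $M$ into $\mathbb{C}$; for $\gamma\in M$ write $\gamma^{(j)}=\sigma_j(\gamma)$. Let $f(x)$ be the monic relative defining polynomial of $\alpha$ over $M$, and for $j=1,\ldots,m$ let $\alpha^{(j1)},\ldots,\alpha^{(jn)}$ be the roots of the polynomial obtained by applying $\sigma_j$ to the coefficients of $f$. The size $\overline{|\alpha|}$ is $\max_{j,k}|\alpha^{(jk)}|$. $|\cdot|$ on vectors is the Euclidean norm. An LLL-reduced basis is meant in the sense of Lenstra–Lenstra–Lovász (with the standard parameter $3/4$, as extended by Pohst), so that its first vector satisfies $|b_1|^2\le 2^{2m-1}|v|^2$ for every nonzero $v\in\mathcal{L}$ (the lattice having rank $2m$). -}

module Defs where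

open import Algebra.Bundles using (CommutativeRing)
open import Algebra.Bundles.Raw using (RawRing)
import Algebra.Construct.NaturalChoice.Max as NaturalMax
import Algebra.Definitions.RawSemiring as RawSemiringDefinitions
open import Algebra.Morphism.Structures using (IsRingHomomorphism)
import Algebra.Properties.Ring as RingProperties
open import Data.Bool.Base using (if_then_else_)
open import Data.Fin.Base using (Fin; toℕ) renaming (_<_ to _<ᶠ_)
open import Data.Fin.Properties using () renaming (_≟_ to _≟ᶠ_; _<?_ to _<ᶠ?_)
open import Data.Integer.Base using (ℤ; +_; -[1+_]; 0ℤ) renaming (∣_∣ to ∣_∣ᶻ)
open import Data.Nat.Base as ℕ using (ℕ; zero; suc; NonZero)
open import Data.Product.Base using (Σ; ∃; _×_; _,_; proj₁; proj₂)
open import Data.Rational.Base using (ℚ; 0ℚ) renaming (+-*-rawRing to ℚ-rawRing)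
open import Data.Sum.Base using (_⊎_; inj₁; inj₂)
open import Data.Vec.Functional using (Vector; []; _∷_; _++_; foldr; map)
open import Function.Base using (_∘_)
open import Level using (Level; _⊔_; 0ℓ) renaming (suc to lsuc)
open import Relation.Binary.Bundles using (DecTotalOrder)
open import Relation.Binary.Core using (Rel)
open import Relation.Binary.PropositionalEquality.Core using (_≡_)
open import Relation.Binary.Structures using (IsDecTotalOrder)
open import Relation.Nullary.Decidable.Core using (does; yes; no)
open import Relation.Nullary.Negation.Core using (¬_)

record Field (c ℓ : Level) : Set (lsuc (c ⊔ ℓ)) where
  field
    commutativeRing : CommutativeRing c ℓ
  open CommutativeRing commutativeRing public
  field
    1≉0     : ¬ (1# ≈ 0#)
    inverse : ∀ x → ¬ (x ≈ 0#) → ∃ λ y → x * y ≈ 1#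

-- The real numbers, up to isomorphism.  The order is decidable because the
-- reals are meant classically.
record CompleteOrderedField : Set₁ where
  field
    fieldStructure : Field 0ℓ 0ℓ
  open Field fieldStructure public
  infix 4 _≤_
  field
    _≤_             : Rel Carrier 0ℓ
    isDecTotalOrder : IsDecTotalOrder _≈_ _≤_
    +-monoˡ-≤       : ∀ {x y} z → x ≤ y → x + z ≤ y + z
    *-nonNeg        : ∀ {x y} → 0# ≤ x → 0# ≤ y → 0# ≤ x * y

  UpperBound : (Carrier → Set) → Carrier → Set
  UpperBound P u = ∀ x → P x → x ≤ u

  field
    complete : (P : Carrier → Set) → ∃ P → ∃ (UpperBound P) →
               ∃ λ s → UpperBound P s × (∀ u → UpperBound P u → s ≤ u)

module RingNotions {c ℓ} (A : RawRing c ℓ) where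
  open RawRing A
  open RawSemiringDefinitions rawSemiring public
    using (_^_; sum; product) renaming (_×_ to _·_)

  fromℕ : ℕ → Carrier
  fromℕ n = n · 1#

  fromℤ : ℤ → Carrier
  fromℤ (+ n)    = fromℕ n
  fromℤ -[1+ n ] = - fromℕ (suc n)

  -- Value at x of Xⁿ + aₙ₋₁Xⁿ⁻¹ + … + a₀.
  evalMonic : ∀ {n} → Vector Carrier n → Carrier → Carrier
  evalMonic {n} a x = (x ^ n) + sum (λ i → a i * (x ^ toℕ i))

  IsAlgebraicInteger : Carrier → Set ℓ
  IsAlgebraicInteger x =
    ∃ λ n → Σ (Vector ℤ n) λ a → evalMonic (λ i → fromℤ (a i)) x ≈ 0#

module Reals (R : CompleteOrderedField) where
  open CompleteOrderedField R public renaming (Carrier to ℝ)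
  open RingNotions rawRing public
  private
    module O = IsDecTotalOrder isDecTotalOrder
    module P = RingProperties ring

  decTotalOrder : DecTotalOrder 0ℓ 0ℓ 0ℓ
  decTotalOrder = record { isDecTotalOrder = isDecTotalOrder }

  open NaturalMax (DecTotalOrder.totalOrder decTotalOrder) public
    using () renaming (_⊔_ to max)

  infix 4 _<_
  _<_ : Rel ℝ 0ℓ
  x < y = x ≤ y × ¬ (x ≈ y)

  ∣_∣ : ℝ → ℝ
  ∣ x ∣ = max x (- x)

  -- With the convention 0 ⁻¹ = 0.
  infix 9 _⁻¹
  _⁻¹ : ℝ → ℝ
  x ⁻¹ with x O.≟ 0#
  ... | yes _   = 0#
  ... | no x≉0  = proj₁ (inverse x x≉0)

  -- Only used for families of nonnegative numbers.
  maximum : ∀ {n} → Vector ℝ n → ℝ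
  maximum = foldr max 0#

  private
    0≤y-x : ∀ {x y} → x ≤ y → 0# ≤ y + - x
    0≤y-x {x} x≤y =
      O.≤-respˡ-≈ (-‿inverseʳ x) (+-monoˡ-≤ (- x) x≤y)

    ≤-from-diff : ∀ {x y} → 0# ≤ y + - x → x ≤ y
    ≤-from-diff {x} {y} p =
      O.≤-respʳ-≈
        (trans (+-assoc y (- x) x)
          (trans (+-congˡ (-‿inverseˡ x)) (+-identityʳ y)))
        (O.≤-respˡ-≈ (+-identityˡ x) (+-monoˡ-≤ x p))

    0≤1 : 0# ≤ 1#
    0≤1 with O.total 0# 1#
    ... | inj₁ p = p
    ... | inj₂ p = O.≤-respʳ-≈ [-1]²≈1 (*-nonNeg 0≤-1 0≤-1)
      where
      0≤-1 : 0# ≤ - 1#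
      0≤-1 = O.≤-respʳ-≈ (+-identityˡ (- 1#)) (0≤y-x p)
      [-1]²≈1 : - 1# * - 1# ≈ 1#
      [-1]²≈1 = trans (P.-1*x≈-x (- 1#)) (P.-‿involutive 1#)

    x≤x*y : ∀ {x y} → 0# ≤ x → 1# ≤ y → x ≤ x * y
    x≤x*y {x} {y} 0≤x 1≤y = ≤-from-diff
      (O.≤-respʳ-≈
        (trans (distribˡ x y (- 1#))
          (+-congˡ (trans (sym (P.-‿distribʳ-* x 1#)) (-‿cong (*-identityʳ x)))))
        (*-nonNeg 0≤x (0≤y-x 1≤y)))

    1≤x^n : ∀ {x} n → 1# ≤ x → 1# ≤ x ^ n
    1≤x^n zero    1≤x = O.refl
    1≤x^n (suc n) 1≤x =
      O.trans 1≤x (x≤x*y (O.trans 0≤1 1≤x) (1≤x^n n 1≤x))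

    x≤x^n : ∀ {x} n .{{_ : NonZero n}} → 1# ≤ x → x ≤ x ^ n
    x≤x^n (suc n) 1≤x = x≤x*y (O.trans 0≤1 1≤x) (1≤x^n n 1≤x)

    x≤max : ∀ x y → x ≤ max x y
    x≤max x y = NaturalMax.x≤x⊔y (DecTotalOrder.totalOrder decTotalOrder) x y

    y≤max : ∀ x y → y ≤ max x y
    y≤max x y = NaturalMax.x≤y⊔x (DecTotalOrder.totalOrder decTotalOrder) x y

  BelowRoot : ℕ → ℝ → ℝ → Set
  BelowRoot k x y = y ≤ 0# ⊎ y ^ k ≤ x

  private
    rootBound : ∀ k .{{_ : NonZero k}} x → UpperBound (BelowRoot k x) (max 1# x)
    rootBound k x y (inj₁ y≤0) = O.trans y≤0 (O.trans 0≤1 (x≤max 1# x))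
    rootBound k x y (inj₂ yᵏ≤x) with O.total y 1#
    ... | inj₁ y≤1 = O.trans y≤1 (x≤max 1# x)
    ... | inj₂ 1≤y = O.trans (x≤x^n k 1≤y) (O.trans yᵏ≤x (y≤max 1# x))

  -- The nonnegative k-th root of x when 0 ≤ x, as sup { y ∣ y ≤ 0 or yᵏ ≤ x }.
  root : (k : ℕ) .{{_ : NonZero k}} → ℝ → ℝ
  root k x = proj₁
    (complete (BelowRoot k x) (0# , inj₁ O.refl) (max 1# x , rootBound k x))

  √_ : ℝ → ℝ
  √ x = root 2 x

  infixl 6 _i+_
  record ℂ : Set where
    constructor _i+_
    field
      Re : ℝ
      Im : ℝ
  open ℂ public

  ℂ-rawRing : RawRing 0ℓ 0ℓ
  ℂ-rawRing = record
    { Carrier = ℂ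
    ; _≈_     = λ z w → Re z ≈ Re w × Im z ≈ Im w
    ; _+_     = λ z w → (Re z + Re w) i+ (Im z + Im w)
    ; _*_     = λ z w → (Re z * Re w - Im z * Im w) i+
                        (Re z * Im w + Im z * Re w)
    ; -_      = λ z → (- Re z) i+ (- Im z)
    ; 0#      = 0# i+ 0#
    ; 1#      = 1# i+ 0#
    }

  module ℂ-Ring where
    open RawRing ℂ-rawRing public hiding (Carrier; rawSemiring)
    open RingNotions ℂ-rawRing public

  infixl 6 _-ᶜ_
  _-ᶜ_ : ℂ → ℂ → ℂ
  z -ᶜ w = (Re z - Re w) i+ (Im z - Im w)

  modulus : ℂ → ℝ
  modulus z = √ (Re z * Re z + Im z * Im z)

  ⟨_,_⟩ : ∀ {d} → Vector ℝ d → Vector ℝ d → ℝ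
  ⟨ v , w ⟩ = sum (λ i → v i * w i)

  norm : ∀ {d} → Vector ℝ d → ℝ
  norm v = √ ⟨ v , v ⟩

  _≋_ : ∀ {d} → Vector ℝ d → Vector ℝ d → Set
  v ≋ w = ∀ i → v i ≈ w i

  linearCombination : ∀ {r d} → Vector ℝ r → Vector (Vector ℝ d) r → Vector ℝ d
  linearCombination a b t = sum (λ i → a i * b i t)

  Lattice : ∀ {r d} → Vector (Vector ℝ d) r → Vector ℝ d → Set
  Lattice {r} g v =
    Σ (Vector ℤ r) λ z → v ≋ linearCombination (λ i → fromℤ (z i)) g

  record IsLatticeBasis {r d} (L : Vector ℝ d → Set)
                        (b : Vector (Vector ℝ d) r) : Set where
    field
      inLattice   : ∀ i → L (b i)
      generates   : ∀ v → L v → Lattice b v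
      independent : ∀ a → linearCombination a b ≋ (λ _ → 0#) → ∀ i → a i ≈ 0#

  record GramSchmidt {r d} (b : Vector (Vector ℝ d) r) : Set where
    field
      b*     : Vector (Vector ℝ d) r
      coeff  : Fin r → Fin r → ℝ
      coeff≈ : ∀ i j → j <ᶠ i →
               coeff i j ≈ ⟨ b i , b* j ⟩ * ⟨ b* j , b* j ⟩ ⁻¹
      b*≋    : ∀ i → b* i ≋ λ t →
               b i t - sum (λ j →
                 if does (j <ᶠ? i) then coeff i j * b* j t else 0#)

  record IsLLLReduced {r d} (b : Vector (Vector ℝ d) r) : Set where
    field
      gramSchmidt : GramSchmidt b
    open GramSchmidt gramSchmidt public
    field
      sizeReduced : ∀ i j → j <ᶠ i → ∣ coeff i j ∣ ≤ fromℕ 2 ⁻¹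
      lovász      : ∀ i j → toℕ i ≡ suc (toℕ j) →
                    let v = λ t → b* i t + coeff i j * b* j t in
                    fromℕ 3 * fromℕ 4 ⁻¹ * ⟨ b* j , b* j ⟩ ≤ ⟨ v , v ⟩

record NumberField (c ℓ : Level) (m : ℕ) : Set (lsuc (c ⊔ ℓ)) where
  field
    fieldStructure : Field c ℓ
  open Field fieldStructure public
  open RingNotions rawRing public
  field
    fromℚ       : ℚ → Carrier
    fromℚ-hom   : IsRingHomomorphism ℚ-rawRing rawRing fromℚ
    ℚ-basis     : Vector Carrier m
    spans       : ∀ x → Σ (Vector ℚ m) λ q →
                  x ≈ sum (λ i → fromℚ (q i) * ℚ-basis i)
    independent : ∀ (q : Vector ℚ m) →
                  sum (λ i → fromℚ (q i) * ℚ-basis i) ≈ 0# → ∀ i → q i ≡ 0ℚ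

  record IsIntegralBasis {r} (ω : Vector Carrier r) : Set (c ⊔ ℓ) where
    field
      integral      : ∀ i → IsAlgebraicInteger (ω i)
      ℤ-spans       : ∀ x → IsAlgebraicInteger x → Σ (Vector ℤ r) λ z →
                      x ≈ sum (λ i → fromℤ (z i) * ω i)
      ℤ-independent : ∀ (z : Vector ℤ r) →
                      sum (λ i → fromℤ (z i) * ω i) ≈ 0# → ∀ i → z i ≡ 0ℤ

module Extension {c ℓ c′ ℓ′} (M : Field c ℓ) (K : Field c′ ℓ′)
                 (ι : Field.Carrier M → Field.Carrier K) where
  private
    module M = Field M
  open Field K
  open RingNotions rawRing

  -- Adjoin α x says that x lies in M(α), the subfield generated by M and α.
  data Adjoin (α : Carrier) : Carrier → Set (c ⊔ c′ ⊔ ℓ′) where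
    base : ∀ x → Adjoin α (ι x)
    gen  : Adjoin α α
    add  : ∀ {x y} → Adjoin α x → Adjoin α y → Adjoin α (x + y)
    mul  : ∀ {x y} → Adjoin α x → Adjoin α y → Adjoin α (x * y)
    neg  : ∀ {x} → Adjoin α x → Adjoin α (- x)
    inv  : ∀ {x y} → Adjoin α x → x * y ≈ 1# → Adjoin α y
    resp : ∀ {x y} → x ≈ y → Adjoin α x → Adjoin α y

  -- f lists the non-leading coefficients of a monic polynomial of degree n,
  -- constant term first.
  record IsMinimalPolynomial {n} (α : Carrier) (f : Vector M.Carrier n)
      : Set (c ⊔ ℓ ⊔ ℓ′) where
    field
      vanishes : evalMonic (ι ∘ f) α ≈ 0#
      minimal  : ∀ (g : Vector M.Carrier n) →
                 sum (λ i → ι (g i) * α ^ toℕ i) ≈ 0# → ∀ i → g i M.≈ M.0#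

-- M has degree m = suc k and K = M(α) has degree n over M.
record Setting (R : CompleteOrderedField) (c ℓ c′ ℓ′ : Level) (k n : ℕ)
    : Set (lsuc (c ⊔ ℓ ⊔ c′ ⊔ ℓ′)) where
  open Reals R using (ℂ; ℂ-rawRing; _-ᶜ_; module ℂ-Ring)
  field
    M : NumberField c ℓ (suc k)
    K : Field c′ ℓ′
  module M = NumberField M
  module K = Field K
  field
    ι     : M.Carrier → K.Carrier
    ι-hom : IsRingHomomorphism M.rawRing K.rawRing ι
  open Extension M.fieldStructure K ι public
  field
    -- ω₂, …, ωₘ
    ω             : Vector M.Carrier k
    integralBasis : M.IsIntegralBasis (M.1# ∷ ω)

    α          : K.Carrier
    α-integral : RingNotions.IsAlgebraicInteger K.rawRing α
    K≡M⟨α⟩     : ∀ x → Adjoin α x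
    f          : Vector M.Carrier n
    f-minimal  : IsMinimalPolynomial α f

    μ          : M.Carrier
    μ-integral : M.IsAlgebraicInteger μ
    μ≉0        : ¬ (μ M.≈ M.0#)

    σ          : Fin (suc k) → M.Carrier → ℂ
    σ-hom      : ∀ j → IsRingHomomorphism M.rawRing ℂ-rawRing (σ j)
    σ-distinct : ∀ j j′ → (∀ x → σ j x ℂ-Ring.≈ σ j′ x) → j ≡ j′
    σ-all      : ∀ τ → IsRingHomomorphism M.rawRing ℂ-rawRing τ →
                 ∃ λ j → ∀ x → τ x ℂ-Ring.≈ σ j x

    -- The roots, with multiplicity, of the polynomial f with σ j applied to
    -- its coefficients.
    αᶜ       : Fin (suc k) → Fin n → ℂ
    αᶜ-roots : ∀ j z → ℂ-Ring.evalMonic (σ j ∘ f) z ℂ-Ring.≈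
               ℂ-Ring.product (λ l → z -ᶜ αᶜ j l)

  S : Fin (suc k) → Vector ℂ (suc k)
  S j = ℂ-Ring.1# ∷ (σ j ∘ ω)

  private
    identityMatrix : Fin (suc k) → Fin (suc k) → ℂ
    identityMatrix j l = if does (j ≟ᶠ l) then ℂ-Ring.1# else ℂ-Ring.0#

    matMul : (A B : Fin (suc k) → Fin (suc k) → ℂ) → Fin (suc k) → Fin (suc k) → ℂ
    matMul A B j l = ℂ-Ring.sum (λ t → A j t ℂ-Ring.* B t l)

  field
    S⁻¹       : Fin (suc k) → Fin (suc k) → ℂ
    S⁻¹-left  : ∀ j l → matMul S⁻¹ S j l ℂ-Ring.≈ identityMatrix j l
    S⁻¹-right : ∀ j l → matMul S S⁻¹ j l ℂ-Ring.≈ identityMatrix j l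

module Constants {R c ℓ c′ ℓ′ k n} (E : Setting R c ℓ c′ ℓ′ k n) where
  open Reals R
  open Setting E using (S; S⁻¹; αᶜ; σ; μ)

  size-α : ℝ
  size-α = maximum (λ j → maximum (λ l → modulus (αᶜ j l)))

  c-hji : Fin (suc k) → Fin n → Fin n → ℝ
  c-hji h j i = fromℕ 2 ⁻¹ * modulus (αᶜ h j -ᶜ αᶜ h i)

  c-hi : Fin (suc k) → Fin n → ℝ
  c-hi h i = modulus (σ h μ) *
           product (λ j → if does (j ≟ᶠ i) then 1# else c-hji h j i) ⁻¹

  c₂ : ℝ
  c₂ = maximum (λ j → sum (λ l → modulus (S⁻¹ j l)))

  c₅ : ℝ
  c₅ = fromℕ 2 * c₂ * size-α

  d-hi : Fin (suc k) → Fin n → ℝ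
  d-hi h i = c-hi h i * c₅ ^ (n ℕ.∸ 1)

  -- The l-th column of the (2m+2) × 2m generating matrix.
  column : Fin (suc k) → Fin n → ℝ →
           Vector (Vector ℝ ((suc k ℕ.+ suc k) ℕ.+ 2)) (suc k ℕ.+ suc k)
  column h i H l =
    (λ t → if does (t ≟ᶠ l) then 1# else 0#) ++
    ((H * Re (entry l)) ∷ (H * Im (entry l)) ∷ [])
    where
    entry : Vector ℂ (suc k ℕ.+ suc k)
    entry = S h ++ map (αᶜ h i ℂ-Ring.*_) (S h)

  linearForm : Fin (suc k) → Fin n → (x y : Vector ℤ (suc k)) → ℂ
  linearForm h i x y =
    ℂ-Ring.sum (λ l → S h l ℂ-Ring.* ℂ-Ring.fromℤ (x l)) -ᶜ
    ℂ-Ring.sum (λ l → (αᶜ h i ℂ-Ring.* S h l) ℂ-Ring.* ℂ-Ring.fromℤ (y l))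

maxAbs : ∀ {r} → Vector ℤ r → ℕ
maxAbs x = foldr (λ z a → ∣ z ∣ᶻ ℕ.⊔ a) 0 x

{-# OPTIONS --safe #-}

-- A solution (x, y) with linear form Λ gives the lattice vector v with
-- coordinates x, −y, H Re Λ, H Im Λ, so ‖v‖² ≤ 2m A₀² + H² |Λ|².  Reducedness
-- gives ‖b₁‖² ≤ 2^(2m−1) ‖v‖²: the Lovász condition bounds ‖b₁‖² by 2^l ‖b*ₗ‖²,
-- and ‖b*ₗ‖² ≤ ‖v‖² when l is the last index with a nonzero coefficient of v.
-- Hence (2m+1) A₀² ≤ 2m A₀² + H² |Λ|², that is A₀ ≤ H |Λ| ≤ H d A^(1−n).
module Submission where

open import Defs
open import Algebra.Bundles using (CommutativeRing)
import Algebra.Construct.NaturalChoice.Max as NaturalMax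
import Algebra.Properties.AbelianGroup as AbelianGroupProperties
import Algebra.Properties.Ring as RingProperties
import Algebra.Properties.Semiring.Mult as SemiringMult
import Algebra.Properties.Semiring.Sum as SemiringSum
import Algebra.Solver.Ring as RingSolver
open import Algebra.Solver.Ring.AlmostCommutativeRing
  using (fromCommutativeRing; _-Raw-AlmostCommutative⟶_)
open import Data.Bool.Base using (true; false; if_then_else_)
open import Data.Fin.Base as Fin using (Fin; zero; suc; toℕ; inject₁; splitAt; _↑ˡ_; _↑ʳ_)
open import Data.Fin.Induction using (<-weakInduction)
import Data.Fin.Properties as Fin
open import Data.Integer.Base as ℤ using (ℤ; +_; -[1+_]; 0ℤ)
import Data.Integer.Properties as ℤ
open import Data.Maybe.Base using (Maybe; just; nothing)
open import Data.Nat.Base as ℕ using (ℕ; zero; suc; NonZero; z≤n; s≤s)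
open import Data.Nat.Induction using (<-rec)
import Data.Nat.Properties as ℕ
open import Data.Product.Base using (∃; _×_; _,_; proj₁; proj₂)
open import Data.Sum.Base using (_⊎_; inj₁; inj₂; [_,_]′)
open import Data.Vec.Functional using (Vector; []; _∷_; _++_)
open import Data.Vec.Functional.Properties using (lookup-++ˡ; lookup-++ʳ)
open import Function.Base using (_∘_)
open import Level using (Level)
open import Relation.Binary.Bundles using (DecTotalOrder)
open import Relation.Binary.Definitions using (tri<; tri≈; tri>)
open import Relation.Binary.PropositionalEquality.Core as ≡ using (_≡_)
import Relation.Binary.Reasoning.PartialOrder as PartialOrderReasoning
import Relation.Binary.Reasoning.Setoid as SetoidReasoning
open import Relation.Nullary.Decidable using (does; yes; no; dec-true; dec-false)
open import Relation.Nullary.Negation.Core using (¬_; contradiction)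

-- The argument about the last nonzero coefficient concerns coefficients of `v` in the reduced
-- basis, whereas x and -y are its coefficients in the generating columns. A change of basis
-- supplies integers `w`, and the identity block of the matrix shows that `w` is not zero: otherwise
-- `v` would vanish, although its first 2m coordinates are x and -y. The exponent 2m-1 is the
-- largest index l counted from zero. The factor 2m+1 exceeds by one the number of integer
-- coordinates of `v`, each of square at most A₀², so exactly one A₀² is left to be paid by H |Λ|.
-- The reals are known only through order completeness, and `root` is a supremum. Norm, modulus and
-- the constant in the hypothesis on b₁ all have to be squared, so `√ x * √ x ≈ x` has to be
-- derived. The conclusion uses less: its root only has to be an upper bound.

-- Integer numerals in a commutative ring, and a ring solver that computes with them.

module IntegerCoefficients {c ℓ} (A : CommutativeRing c ℓ) where
  open CommutativeRing A
  open RingNotions rawRing using (fromℕ; fromℤ)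
  open RingProperties ring
    using (-‿distribˡ-*; -‿distribʳ-*; -‿involutive; -0#≈0#)
  open AbelianGroupProperties +-abelianGroup
    using () renaming (⁻¹-∙-comm to -‿+-comm)
  open SemiringMult semiring using (×-homo-+; ×1-homo-*)
  open SetoidReasoning setoid

  -- Calculated by hand because the solver rests on it: it gives the recursive case of `fromℤ-⊖`,
  -- hence additivity of `fromℤ`.
  cancel-1 : ∀ x y → x - y ≈ (1# + x) - (1# + y)
  cancel-1 x y = sym (begin
    (1# + x) + - (1# + y)      ≈⟨ +-cong (+-comm x 1#) (-‿+-comm 1# y) ⟨
    (x + 1#) + (- 1# + - y)    ≈⟨ +-assoc x 1# _ ⟩
    x + (1# + (- 1# + - y))    ≈⟨ +-congˡ (+-assoc 1# (- 1#) (- y)) ⟨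
    x + ((1# + - 1#) + - y)    ≈⟨ +-congˡ (+-congʳ (-‿inverseʳ 1#)) ⟩
    x + (0# + - y)             ≈⟨ +-congˡ (+-identityˡ (- y)) ⟩
    x - y                      ∎)

  fromℤ-⊖ : ∀ m n → fromℤ (m ℤ.⊖ n) ≈ fromℕ m - fromℕ n
  fromℤ-⊖ m       zero    = sym (trans (+-congˡ -0#≈0#) (+-identityʳ _))
  fromℤ-⊖ zero    (suc n) = sym (+-identityˡ _)
  fromℤ-⊖ (suc m) (suc n) rewrite ℤ.[1+m]⊖[1+n]≡m⊖n m n =
    trans (fromℤ-⊖ m n) (cancel-1 (fromℕ m) (fromℕ n))

  fromℤ-neg : ∀ z → fromℤ (ℤ.- z) ≈ - fromℤ z
  fromℤ-neg (+ zero)  = sym -0#≈0#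
  fromℤ-neg (+ suc n) = refl
  fromℤ-neg -[1+ n ]  = sym (-‿involutive _)

  fromℤ-+ : ∀ i j → fromℤ (i ℤ.+ j) ≈ fromℤ i + fromℤ j
  fromℤ-+ (+ m)    (+ n)    = ×-homo-+ 1# m n
  fromℤ-+ (+ m)    -[1+ n ] = fromℤ-⊖ m (suc n)
  fromℤ-+ -[1+ m ] (+ n)    = trans (fromℤ-⊖ n (suc m)) (+-comm _ _)
  fromℤ-+ -[1+ m ] -[1+ n ] = begin
    - fromℕ (suc (suc (m ℕ.+ n)))      ≡⟨ ≡.cong (-_ ∘ fromℕ ∘ suc) (ℕ.+-suc m n) ⟨
    - fromℕ (suc m ℕ.+ suc n)          ≈⟨ -‿cong (×-homo-+ 1# (suc m) (suc n)) ⟩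
    - (fromℕ (suc m) + fromℕ (suc n))  ≈⟨ -‿+-comm _ _ ⟨
    - fromℕ (suc m) + - fromℕ (suc n)  ∎

  fromℤ-pos-* : ∀ m j → fromℤ (+ m ℤ.* j) ≈ fromℕ m * fromℤ j
  fromℤ-pos-* m (+ n) rewrite ≡.sym (ℤ.pos-* m n) = ×1-homo-* m n
  fromℤ-pos-* m -[1+ n ] rewrite ≡.sym (ℤ.neg-distribʳ-* (+ m) (+ suc n)) = begin
    fromℤ (ℤ.- (+ m ℤ.* + suc n))  ≈⟨ fromℤ-neg (+ m ℤ.* + suc n) ⟩
    - fromℤ (+ m ℤ.* + suc n)      ≈⟨ -‿cong (fromℤ-pos-* m (+ suc n)) ⟩
    - (fromℕ m * fromℕ (suc n))    ≈⟨ -‿distribʳ-* _ _ ⟩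
    fromℕ m * - fromℕ (suc n)      ∎

  fromℤ-* : ∀ i j → fromℤ (i ℤ.* j) ≈ fromℤ i * fromℤ j
  fromℤ-* (+ m) j = fromℤ-pos-* m j
  fromℤ-* -[1+ m ] j rewrite ≡.sym (ℤ.neg-distribˡ-* (+ suc m) j) = begin
    fromℤ (ℤ.- (+ suc m ℤ.* j))    ≈⟨ fromℤ-neg (+ suc m ℤ.* j) ⟩
    - fromℤ (+ suc m ℤ.* j)        ≈⟨ -‿cong (fromℤ-pos-* (suc m) j) ⟩
    - (fromℕ (suc m) * fromℤ j)    ≈⟨ -‿distribˡ-* _ _ ⟩
    - fromℕ (suc m) * fromℤ j      ∎

  -- The solver must add, multiply and compare coefficients. Integers compute, elements of an
  -- abstract ring do not. With this choice `con (+ 2)` denotes `fromℕ 2`, and `con (+ 1)` denotes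
  -- `fromℕ 1`, which unfolds to `1# + 0#` and not to `1#`.
  homomorphism : ℤ.+-*-rawRing -Raw-AlmostCommutative⟶ fromCommutativeRing A
  homomorphism = record
    { ⟦_⟧    = fromℤ
    ; +-homo = fromℤ-+
    ; *-homo = fromℤ-*
    ; -‿homo = fromℤ-neg
    ; 0-homo = refl
    ; 1-homo = +-identityʳ 1#
    }

  -- Only positive evidence is required. Distinct integers may have equal images, for instance in
  -- positive characteristic, so they are answered by `nothing` and not by a refutation.
  decide : ∀ i j → Maybe (fromℤ i ≈ fromℤ j)
  decide i j with i ℤ.≟ j
  ... | yes i≡j = just (reflexive (≡.cong fromℤ i≡j))
  ... | no  _   = nothing

  open RingSolver ℤ.+-*-rawRing (fromCommutativeRing A) homomorphism decide public
    using (solve; _:=_; con; _:+_; _:*_; _:-_; :-_)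

-- Ordered field arithmetic and square roots.

module OrderedField (R : CompleteOrderedField) where
  open Reals R hiding (zero)
  open IntegerCoefficients commutativeRing public
  open RingProperties ring using (x∙y⁻¹≈ε⇒x≈y)
  open SemiringMult semiring public using (×1-homo-*)
  private
    module O = DecTotalOrder decTotalOrder
  open NaturalMax O.totalOrder public using (x≤x⊔y; x≤y⊔x)
  module ≤-Reasoning = PartialOrderReasoning O.poset
  open ≤-Reasoning
  open O public using (_≟_; ≤-respˡ-≈; ≤-respʳ-≈) renaming
    (refl to ≤-refl; reflexive to ≤-reflexive; trans to ≤-trans; antisym to ≤-antisym
    ; total to ≤-total)

  x≤y⇒0≤y-x : ∀ {x y} → x ≤ y → 0# ≤ y - x
  x≤y⇒0≤y-x {x} x≤y = ≤-respˡ-≈ (-‿inverseʳ x) (+-monoˡ-≤ (- x) x≤y)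

  0≤y-x⇒x≤y : ∀ {x y} → 0# ≤ y - x → x ≤ y
  0≤y-x⇒x≤y {x} {y} 0≤y-x = begin
    x            ≈⟨ +-identityˡ x ⟨
    0# + x       ≤⟨ +-monoˡ-≤ x 0≤y-x ⟩
    (y - x) + x  ≈⟨ solve 2 (λ x y → (y :- x) :+ x := y) refl x y ⟩
    y            ∎

  +-mono-≤ : ∀ {x y u v} → x ≤ y → u ≤ v → x + u ≤ y + v
  +-mono-≤ {x} {y} {u} {v} x≤y u≤v = begin
    x + u  ≤⟨ +-monoˡ-≤ u x≤y ⟩
    y + u  ≈⟨ +-comm y u ⟩
    u + y  ≤⟨ +-monoˡ-≤ y u≤v ⟩
    v + y  ≈⟨ +-comm v y ⟩
    y + v  ∎

  +-nonNeg : ∀ {x y} → 0# ≤ x → 0# ≤ y → 0# ≤ x + y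
  +-nonNeg 0≤x 0≤y = ≤-respˡ-≈ (+-identityˡ 0#) (+-mono-≤ 0≤x 0≤y)

  +-cancelʳ-≤ : ∀ {x y} z → x + z ≤ y + z → x ≤ y
  +-cancelʳ-≤ {x} {y} z x+z≤y+z = 0≤y-x⇒x≤y (begin
    0#                 ≤⟨ x≤y⇒0≤y-x x+z≤y+z ⟩
    (y + z) - (x + z)  ≈⟨ solve 3 (λ x y z → (y :+ z) :- (x :+ z) := y :- x) refl x y z ⟩
    y - x              ∎)

  *-monoʳ-≤ : ∀ {x y z} → 0# ≤ z → x ≤ y → z * x ≤ z * y
  *-monoʳ-≤ {x} {y} {z} 0≤z x≤y = 0≤y-x⇒x≤y (begin
    0#               ≤⟨ *-nonNeg 0≤z (x≤y⇒0≤y-x x≤y) ⟩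
    z * (y - x)      ≈⟨ solve 3 (λ x y z → z :* (y :- x) := z :* y :- z :* x) refl x y z ⟩
    z * y - z * x    ∎)

  *-mono-≤ : ∀ {x y u v} → 0# ≤ y → 0# ≤ u → x ≤ y → u ≤ v → x * u ≤ y * v
  *-mono-≤ {x} {y} {u} {v} 0≤y 0≤u x≤y u≤v = begin
    x * u  ≈⟨ *-comm x u ⟩
    u * x  ≤⟨ *-monoʳ-≤ 0≤u x≤y ⟩
    u * y  ≈⟨ *-comm u y ⟩
    y * u  ≤⟨ *-monoʳ-≤ 0≤y u≤v ⟩
    y * v  ∎

  0≤x² : ∀ x → 0# ≤ x * x
  0≤x² x = [ (λ 0≤x → *-nonNeg 0≤x 0≤x) , negative ]′ (≤-total 0# x)
    where
    negative : x ≤ 0# → 0# ≤ x * x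
    negative x≤0 = begin
      0#                     ≤⟨ *-nonNeg (x≤y⇒0≤y-x x≤0) (x≤y⇒0≤y-x x≤0) ⟩
      (0# - x) * (0# - x)    ≈⟨ solve 1 (λ x → (con 0ℤ :- x) :* (con 0ℤ :- x) := x :* x) refl x ⟩
      x * x                  ∎

  0≤1 : 0# ≤ 1#
  0≤1 = ≤-respʳ-≈ (*-identityˡ 1#) (0≤x² 1#)

  0≤fromℕ : ∀ n → 0# ≤ fromℕ n
  0≤fromℕ zero    = ≤-refl
  0≤fromℕ (suc n) = +-nonNeg 0≤1 (0≤fromℕ n)

  fromℕ-mono-≤ : ∀ {m n} → m ℕ.≤ n → fromℕ m ≤ fromℕ n
  fromℕ-mono-≤ {n = n} z≤n = 0≤fromℕ n
  fromℕ-mono-≤ (s≤s m≤n) = +-mono-≤ ≤-refl (fromℕ-mono-≤ m≤n)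

  1≤x⇒0<x : ∀ {x} → 1# ≤ x → 0# < x
  1≤x⇒0<x 1≤x = ≤-trans 0≤1 1≤x ,
    λ 0≈x → 1≉0 (≤-antisym (≤-respʳ-≈ (sym 0≈x) 1≤x) 0≤1)

  1≤fromℕ : ∀ n → .{{NonZero n}} → 1# ≤ fromℕ n
  1≤fromℕ (suc n) = ≤-respˡ-≈ (+-identityʳ 1#) (+-mono-≤ ≤-refl (0≤fromℕ n))

  0<fromℕ : ∀ n → .{{NonZero n}} → 0# < fromℕ n
  0<fromℕ n = 1≤x⇒0<x (1≤fromℕ n)

  1≤x^n : ∀ {x} n → 1# ≤ x → 1# ≤ x ^ n
  1≤x^n         zero    1≤x = ≤-refl
  1≤x^n {x = x} (suc n) 1≤x = ≤-respˡ-≈ (*-identityʳ 1#)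
    (*-mono-≤ (≤-trans 0≤1 1≤x) 0≤1 1≤x (1≤x^n n 1≤x))

  *-inverseʳ : ∀ {x} → ¬ (x ≈ 0#) → x * x ⁻¹ ≈ 1#
  *-inverseʳ {x} x≉0 with x ≟ 0#
  ... | yes x≈0 = contradiction x≈0 x≉0
  ... | no  x≉0′ = proj₂ (inverse x x≉0′)

  *-inverseʳ-pos : ∀ {x} → 0# < x → x * x ⁻¹ ≈ 1#
  *-inverseʳ-pos (_ , 0≉x) = *-inverseʳ (0≉x ∘ sym)

  *-cancelˡ-≈ : ∀ {x y z} → ¬ (z ≈ 0#) → z * x ≈ z * y → x ≈ y
  *-cancelˡ-≈ {x} {y} {z} z≉0 zx≈zy = trans (sym (undo x)) (trans (*-congʳ zx≈zy) (undo y))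
    where
    undo : ∀ u → z * u * z ⁻¹ ≈ u
    undo u = trans (solve 3 (λ z u w → z :* u :* w := z :* w :* u) refl z u (z ⁻¹))
      (trans (*-congʳ (*-inverseʳ z≉0)) (*-identityˡ u))

  -- By totality only `y ≤ x` needs work. Multiplying it by `z` turns the hypothesis into an
  -- equation, from which `z` cancels.
  *-cancelˡ-≤ : ∀ {x y z} → 0# < z → z * x ≤ z * y → x ≤ y
  *-cancelˡ-≤ {x} {y} {z} (0≤z , 0≉z) zx≤zy with ≤-total x y
  ... | inj₁ x≤y = x≤y
  ... | inj₂ y≤x = ≤-reflexive
    (*-cancelˡ-≈ (0≉z ∘ sym) (≤-antisym zx≤zy (*-monoʳ-≤ 0≤z y≤x)))

  x²≈0⇒x≈0 : ∀ {x} → x * x ≈ 0# → x ≈ 0#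
  x²≈0⇒x≈0 {x} x²≈0 with x ≟ 0#
  ... | yes x≈0 = x≈0
  ... | no  x≉0 = *-cancelˡ-≈ x≉0 (trans x²≈0 (sym (zeroʳ x)))

  x-y≈0⇒x≈y : ∀ {x y} → x - y ≈ 0# → x ≈ y
  x-y≈0⇒x≈y {x} {y} = x∙y⁻¹≈ε⇒x≈y x y

  -- If `y ≤ x`, both summands of (x - y)² = (x² - y²) + 2 (y² - yx) are at most 0. The square is
  -- therefore 0, and x and y agree.
  x²≤y²⇒x≤y : ∀ {x y} → 0# ≤ y → x * x ≤ y * y → x ≤ y
  x²≤y²⇒x≤y {x} {y} 0≤y x²≤y² with ≤-total x y
  ... | inj₁ x≤y = x≤y
  ... | inj₂ y≤x = ≤-reflexive (x-y≈0⇒x≈y (x²≈0⇒x≈0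
    (≤-antisym (begin
      (x - y) * (x - y)                        ≈⟨ solve 2 (λ x y → (x :- y) :* (x :- y) :=
                                                    (x :* x :- y :* y) :+ con (+ 2) :* (y :* y :- y :* x)) refl x y ⟩
      (x * x - y * y) + fromℕ 2 * (y * y - y * x)  ≤⟨ +-mono-≤ (x-y≤0 x²≤y²)
                                                       (*-monoʳ-≤ (0≤fromℕ 2) (x-y≤0 (*-monoʳ-≤ 0≤y y≤x))) ⟩
      0# + fromℕ 2 * 0#                        ≈⟨ solve 0 (con 0ℤ :+ con (+ 2) :* con 0ℤ := con 0ℤ) refl ⟩
      0#                                       ∎)
    (0≤x² _))))
    where
    x-y≤0 : ∀ {x y} → x ≤ y → x - y ≤ 0#
    x-y≤0 {x} {y} x≤y = ≤-respʳ-≈ (-‿inverseʳ y) (+-monoˡ-≤ (- y) x≤y)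

  root-isLub : ∀ k .{{_ : NonZero k}} x →
    UpperBound (BelowRoot k x) (root k x) ×
    (∀ u → UpperBound (BelowRoot k x) u → root k x ≤ u)
  root-isLub k x = proj₂ (complete (BelowRoot k x) _ _)

  -- The upper-bound half of the supremum property, which is all that the root of order n-1 in the
  -- conclusion calls for.
  xᵏ≤y⇒x≤root : ∀ k .{{_ : NonZero k}} {x y} → x ^ k ≤ y → x ≤ root k y
  xᵏ≤y⇒x≤root k {x} {y} xᵏ≤y = proj₁ (root-isLub k y) x (inj₂ xᵏ≤y)

  -- Zero lies in `BelowRoot k x` by its first alternative, whatever the sign of `x`.
  0≤root : ∀ k .{{_ : NonZero k}} x → 0# ≤ root k x
  0≤root k x = proj₁ (root-isLub k x) 0# (inj₁ ≤-refl)

  x²≈x*x : ∀ x → x ^ 2 ≈ x * x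
  x²≈x*x x = *-congˡ (*-identityʳ x)

  -- With c² ≥ x, the Möbius map s ↦ (s c + x) / (s + c) moves s towards the
  -- square root without crossing it: s² ≤ x gives a larger y with y² ≤ x,
  -- and x ≤ s² a smaller y with x ≤ y².
  √x*√x≈x : ∀ {x} → 0# ≤ x → √ x * √ x ≈ x
  √x*√x≈x {x} 0≤x = [ (λ s²≤x → ≤-antisym s²≤x (x≤s² s²≤x)) ,
                      (λ x≤s² → ≤-antisym (s²≤x x≤s²) x≤s²) ]′ (≤-total (s * s) x)
    where
    s = √ x
    -- This choice gives c² - x = 1 + x + x² ≥ 0 and keeps the denominator `t` at least 1 even if
    -- `s` is 0.
    c = fromℕ 1 + x
    t = s + c
    y = (s * c + x) * t ⁻¹

    0≤s : 0# ≤ s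
    0≤s = 0≤root 2 x

    0≤c : 0# ≤ c
    0≤c = +-nonNeg (0≤fromℕ 1) 0≤x

    0<t : 0# < t
    0<t = 1≤x⇒0<x (begin
      1#             ≈⟨ trans (+-identityˡ _) (+-identityʳ 1#) ⟨
      0# + (1# + 0#) ≤⟨ +-mono-≤ 0≤s (+-mono-≤ (1≤fromℕ 1) 0≤x) ⟩
      t              ∎)

    t*y : t * y ≈ s * c + x
    t*y = trans (solve 3 (λ t u w → t :* (u :* w) := (t :* w) :* u) refl t (s * c + x) (t ⁻¹))
      (trans (*-congʳ (*-inverseʳ-pos 0<t)) (*-identityˡ _))

    0≤y : 0# ≤ y
    0≤y = *-cancelˡ-≤ 0<t (begin
      t * 0#      ≈⟨ zeroʳ t ⟩
      0#          ≤⟨ +-nonNeg (*-nonNeg 0≤s 0≤c) 0≤x ⟩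
      s * c + x   ≈⟨ t*y ⟨
      t * y       ∎)

    0≤c²-x : 0# ≤ c * c - x
    0≤c²-x = begin
      0#                       ≤⟨ +-nonNeg 0≤c (0≤x² x) ⟩
      (fromℕ 1 + x) + x * x    ≈⟨ solve 1 (λ x → con (+ 1) :+ x :+ x :* x
                                    := (con (+ 1) :+ x) :* (con (+ 1) :+ x) :- x) refl x ⟩
      c * c - x                ∎

    -- The factor c² - x is the determinant of the Möbius map. As it is nonnegative, y² - x cannot
    -- have the sign opposite to that of s² - x.
    t²[y²-x] : t * t * (y * y - x) ≈ (s * s - x) * (c * c - x)
    t²[y²-x] = begin-equality
      t * t * (y * y - x)                     ≈⟨ solve 3 (λ t y x → t :* t :* (y :* y :- x)
                                                   := (t :* y) :* (t :* y) :- t :* t :* x) refl t y x ⟩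
      (t * y) * (t * y) - t * t * x           ≈⟨ +-congʳ (*-cong t*y t*y) ⟩
      (s * c + x) * (s * c + x) - t * t * x   ≈⟨ solve 3 (λ s c x →
                                                   (s :* c :+ x) :* (s :* c :+ x) :- (s :+ c) :* (s :+ c) :* x
                                                   := (s :* s :- x) :* (c :* c :- x)) refl s c x ⟩
      (s * s - x) * (c * c - x)               ∎

    t[y-s] : t * (y - s) ≈ x - s * s
    t[y-s] = begin-equality
      t * (y - s)              ≈⟨ solve 3 (λ t y s → t :* (y :- s) := t :* y :- t :* s) refl t y s ⟩
      t * y - t * s            ≈⟨ +-congʳ t*y ⟩
      (s * c + x) - t * s      ≈⟨ solve 3 (λ s c x → (s :* c :+ x) :- (s :+ c) :* s := x :- s :* s) refl s c x ⟩
      x - s * s                ∎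

    0<t² : 0# < t * t
    0<t² = 0≤x² t , (proj₂ 0<t ∘ sym ∘ x²≈0⇒x≈0 ∘ sym)

    x≤s² : s * s ≤ x → x ≤ s * s
    x≤s² s²≤x = 0≤y-x⇒x≤y (begin
      0#             ≤⟨ *-nonNeg (proj₁ 0<t) (x≤y⇒0≤y-x y≤s) ⟩
      t * (s - y)    ≈⟨ solve 3 (λ t s y → t :* (s :- y) := :- (t :* (y :- s))) refl t s y ⟩
      - (t * (y - s)) ≈⟨ -‿cong t[y-s] ⟩
      - (x - s * s)  ≈⟨ solve 2 (λ x s → :- (x :- s :* s) := s :* s :- x) refl x s ⟩
      s * s - x      ∎)
      where
      y²≤x : y * y ≤ x
      y²≤x = 0≤y-x⇒x≤y (*-cancelˡ-≤ 0<t² (begin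
        t * t * 0#                 ≈⟨ zeroʳ (t * t) ⟩
        0#                         ≤⟨ *-nonNeg (x≤y⇒0≤y-x s²≤x) 0≤c²-x ⟩
        (x - s * s) * (c * c - x)  ≈⟨ solve 3 (λ x s u → (x :- s :* s) :* u := :- ((s :* s :- x) :* u))
                                        refl x s (c * c - x) ⟩
        - ((s * s - x) * (c * c - x))  ≈⟨ -‿cong t²[y²-x] ⟨
        - (t * t * (y * y - x))    ≈⟨ solve 3 (λ t y x → :- (t :* t :* (y :* y :- x)) := t :* t :* (x :- y :* y))
                                        refl t y x ⟩
        t * t * (x - y * y)        ∎))
      y≤s : y ≤ s
      y≤s = xᵏ≤y⇒x≤root 2 (≤-respˡ-≈ (sym (x²≈x*x y)) y²≤x)

    s²≤x : x ≤ s * s → s * s ≤ x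
    s²≤x x≤s² = 0≤y-x⇒x≤y (begin
      0#           ≤⟨ *-nonNeg (proj₁ 0<t) (x≤y⇒0≤y-x s≤y) ⟩
      t * (y - s)  ≈⟨ t[y-s] ⟩
      x - s * s    ∎)
      where
      x≤y² : x ≤ y * y
      x≤y² = 0≤y-x⇒x≤y (*-cancelˡ-≤ 0<t² (begin
        t * t * 0#                 ≈⟨ zeroʳ (t * t) ⟩
        0#                         ≤⟨ *-nonNeg (x≤y⇒0≤y-x x≤s²) 0≤c²-x ⟩
        (s * s - x) * (c * c - x)  ≈⟨ t²[y²-x] ⟨
        t * t * (y * y - x)        ∎))
      s≤y : s ≤ y
      -- Here `y` is an upper bound of the set whose supremum is `s`: a member is either at most 0 ≤
      -- y, or has square at most x ≤ y².
      s≤y = proj₂ (root-isLub 2 x) y λ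
        { z (inj₁ z≤0)  → ≤-trans z≤0 0≤y
        ; z (inj₂ z²≤x) → x²≤y²⇒x≤y 0≤y (≤-trans (≤-respˡ-≈ (x²≈x*x z) z²≤x) x≤y²)
        }

  fromℤ² : ∀ z → fromℤ z * fromℤ z ≈ fromℕ ℤ.∣ z ∣ * fromℕ ℤ.∣ z ∣
  fromℤ² (+ n)    = refl
  fromℤ² -[1+ n ] = solve 1 (λ x → :- x :* :- x := x :* x) refl (fromℕ (suc n))

  -- The point where integrality enters: a nonzero integer cannot be small.
  1≤fromℤ² : ∀ z → ¬ (z ≡ 0ℤ) → 1# ≤ fromℤ z * fromℤ z
  1≤fromℤ² z z≢0 = begin
    1#                                ≈⟨ *-identityʳ 1# ⟨
    1# * 1#                           ≤⟨ *-mono-≤ (0≤fromℕ ℤ.∣ z ∣) 0≤1 1≤∣z∣ 1≤∣z∣ ⟩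
    fromℕ ℤ.∣ z ∣ * fromℕ ℤ.∣ z ∣     ≈⟨ fromℤ² z ⟨
    fromℤ z * fromℤ z                 ∎
    where
    1≤∣z∣ : 1# ≤ fromℕ ℤ.∣ z ∣
    1≤∣z∣ = 1≤fromℕ ℤ.∣ z ∣ {{ℕ.≢-nonZero (z≢0 ∘ ℤ.∣i∣≡0⇒i≡0)}}

-- Finite families of integers and of real numbers.

-- A refuted universal statement carries no witness, so `search` decides the entries. It treats the
-- tail before the head, which makes the first hit the last nonzero entry.
lastNonzero : ∀ {r} (z : Vector ℤ r) → ¬ (∀ i → z i ≡ 0ℤ) →
  ∃ λ l → ¬ (z l ≡ 0ℤ) × (∀ i → l Fin.< i → z i ≡ 0ℤ)
lastNonzero {r} z z≢0 with search z
  where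
  search : ∀ {r} (z : Vector ℤ r) → (∀ i → z i ≡ 0ℤ) ⊎
    ∃ λ l → ¬ (z l ≡ 0ℤ) × (∀ i → l Fin.< i → z i ≡ 0ℤ)
  search {zero}  z = inj₁ λ ()
  search {suc r} z with search (z ∘ suc)
  ... | inj₂ (l , zₗ≢0 , above) = inj₂ (suc l , zₗ≢0 , λ { (suc i) (s≤s l<i) → above i l<i })
  ... | inj₁ tail≡0 with z zero ℤ.≟ 0ℤ
  ...   | yes z₀≡0 = inj₁ λ { zero → z₀≡0 ; (suc i) → tail≡0 i }
  ...   | no  z₀≢0 = inj₂ (zero , z₀≢0 , λ { (suc i) _ → tail≡0 i })
... | inj₁ z≡0   = contradiction z≡0 z≢0
... | inj₂ found = found

module Sums (R : CompleteOrderedField) where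
  open Reals R hiding (zero)
  open OrderedField R
  open SemiringSum semiring public
    using (*-distribˡ-sum; sum-replicate-zero; ∑-distrib-+; ∑-comm)
    renaming (sum-cong-≋ to sum-cong)

  sum-≈0 : ∀ {n} {f : Vector ℝ n} → (∀ i → f i ≈ 0#) → sum f ≈ 0#
  sum-≈0 {n} f≈0 = trans (sum-cong f≈0) (sum-replicate-zero n)

  sum-single : ∀ {n} (f : Vector ℝ n) k → (∀ i → ¬ (i ≡ k) → f i ≈ 0#) → sum f ≈ f k
  sum-single f zero    f≈0 = trans (+-congˡ (sum-≈0 λ i → f≈0 (suc i) λ ())) (+-identityʳ _)
  sum-single f (suc k) f≈0 = trans
    (+-cong (f≈0 zero λ ()) (sum-single (f ∘ suc) k λ i i≢k → f≈0 (suc i) (i≢k ∘ Fin.suc-injective)))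
    (+-identityˡ _)

  sum-↑ : ∀ m {n} (f : Vector ℝ (m ℕ.+ n)) →
    sum f ≈ sum (λ i → f (i ↑ˡ n)) + sum (λ i → f (m ↑ʳ i))
  sum-↑ zero    f = sym (+-identityˡ _)
  sum-↑ (suc m) f = trans (+-congˡ (sum-↑ m (f ∘ suc))) (sym (+-assoc _ _ _))

  sum-nonNeg : ∀ {n} {f : Vector ℝ n} → (∀ i → 0# ≤ f i) → 0# ≤ sum f
  sum-nonNeg {zero}  0≤f = ≤-refl
  sum-nonNeg {suc n} 0≤f = +-nonNeg (0≤f zero) (sum-nonNeg (0≤f ∘ suc))

  sum-≤ : ∀ {n u} {f : Vector ℝ n} → (∀ i → f i ≤ u) → sum f ≤ fromℕ n * u
  sum-≤ {zero}  {u} f≤u = ≤-reflexive (sym (zeroˡ u))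
  sum-≤ {suc n} {u} f≤u = ≤-respʳ-≈
    (trans (+-congʳ (sym (*-identityˡ u))) (sym (distribʳ u 1# (fromℕ n))))
    (+-mono-≤ (f≤u zero) (sum-≤ (f≤u ∘ suc)))

-- The Euclidean inner product.

module InnerProduct (R : CompleteOrderedField) where
  open Reals R hiding (zero)
  open OrderedField R
  open Sums R
  open ≤-Reasoning

  ⟨⟩-cong : ∀ {d} {u u′ v v′ : Vector ℝ d} → u ≋ u′ → v ≋ v′ → ⟨ u , v ⟩ ≈ ⟨ u′ , v′ ⟩
  ⟨⟩-cong u≋u′ v≋v′ = sum-cong λ t → *-cong (u≋u′ t) (v≋v′ t)

  ⟨⟩-comm : ∀ {d} (u v : Vector ℝ d) → ⟨ u , v ⟩ ≈ ⟨ v , u ⟩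
  ⟨⟩-comm u v = sum-cong λ t → *-comm (u t) (v t)

  ⟨⟩-nonNeg : ∀ {d} (v : Vector ℝ d) → 0# ≤ ⟨ v , v ⟩
  ⟨⟩-nonNeg v = sum-nonNeg (0≤x² ∘ v)

  -- The shape u + a v serves, directly or through `⟨⟩-expand`, the Gram-Schmidt relation (a = 1),
  -- the vector in the Lovász condition (a = `coeff i j`) and the removal of a component (a =
  -- `- aₗ`).
  ⟨⟩-linear : ∀ {d} (u v w : Vector ℝ d) a →
    ⟨ (λ t → u t + a * v t) , w ⟩ ≈ ⟨ u , w ⟩ + a * ⟨ v , w ⟩
  ⟨⟩-linear u v w a = begin-equality
    sum (λ t → (u t + a * v t) * w t)        ≈⟨ sum-cong (λ t → solve 4 (λ u v w a →
                                                  (u :+ a :* v) :* w := u :* w :+ a :* (v :* w))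
                                                  refl (u t) (v t) (w t) a) ⟩
    sum (λ t → u t * w t + a * (v t * w t))  ≈⟨ ∑-distrib-+ (λ t → u t * w t) (λ t → a * (v t * w t)) ⟩
    ⟨ u , w ⟩ + sum (λ t → a * (v t * w t))  ≈⟨ +-congˡ (*-distribˡ-sum a (λ t → v t * w t)) ⟨
    ⟨ u , w ⟩ + a * ⟨ v , w ⟩                ∎

  ⟨⟩-lc : ∀ {r d} (a : Vector ℝ r) (b : Vector (Vector ℝ d) r) w →
    ⟨ linearCombination a b , w ⟩ ≈ sum (λ i → a i * ⟨ b i , w ⟩)
  ⟨⟩-lc a b w = begin-equality
    sum (λ t → sum (λ i → a i * b i t) * w t)   ≈⟨ sum-cong (λ t → trans (*-comm _ (w t))
                                                    (*-distribˡ-sum (w t) (λ i → a i * b i t))) ⟩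
    sum (λ t → sum (λ i → w t * (a i * b i t))) ≈⟨ ∑-comm (λ t i → w t * (a i * b i t)) ⟩
    sum (λ i → sum (λ t → w t * (a i * b i t))) ≈⟨ sum-cong (λ i → trans (sum-cong λ t →
                                                    solve 3 (λ w a b → w :* (a :* b) := a :* (b :* w))
                                                      refl (w t) (a i) (b i t))
                                                    (sym (*-distribˡ-sum (a i) (λ t → b i t * w t)))) ⟩
    sum (λ i → a i * ⟨ b i , w ⟩)               ∎

  ⟨⟩-expand : ∀ {d} (u v : Vector ℝ d) a → let w = λ t → u t + a * v t in
    ⟨ w , w ⟩ ≈ ⟨ u , u ⟩ + fromℕ 2 * (a * ⟨ u , v ⟩) + a * a * ⟨ v , v ⟩
  ⟨⟩-expand u v a = begin-equality
    ⟨ w , w ⟩                                                ≈⟨ ⟨⟩-linear u v w a ⟩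
    ⟨ u , w ⟩ + a * ⟨ v , w ⟩                                ≈⟨ +-cong (⟨⟩-comm u w) (*-congˡ (⟨⟩-comm v w)) ⟩
    ⟨ w , u ⟩ + a * ⟨ w , v ⟩                                ≈⟨ +-cong (⟨⟩-linear u v u a) (*-congˡ (⟨⟩-linear u v v a)) ⟩
    (⟨ u , u ⟩ + a * ⟨ v , u ⟩) + a * (⟨ u , v ⟩ + a * ⟨ v , v ⟩)
                                                             ≈⟨ +-congʳ (+-congˡ (*-congˡ (⟨⟩-comm v u))) ⟩
    (⟨ u , u ⟩ + a * ⟨ u , v ⟩) + a * (⟨ u , v ⟩ + a * ⟨ v , v ⟩)
                                                             ≈⟨ solve 4 (λ uu uv vv a →
                                                                  (uu :+ a :* uv) :+ a :* (uv :+ a :* vv)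
                                                                  := uu :+ con (+ 2) :* (a :* uv) :+ a :* a :* vv)
                                                                  refl ⟨ u , u ⟩ ⟨ u , v ⟩ ⟨ v , v ⟩ a ⟩
    ⟨ u , u ⟩ + fromℕ 2 * (a * ⟨ u , v ⟩) + a * a * ⟨ v , v ⟩  ∎
    where w = λ t → u t + a * v t

  ⟨v,v⟩≈0⇒v≋0 : ∀ {d} (v : Vector ℝ d) → ⟨ v , v ⟩ ≈ 0# → v ≋ λ _ → 0#
  ⟨v,v⟩≈0⇒v≋0 {suc d} v v²≈0 zero = x²≈0⇒x≈0 (≤-antisym
    (≤-respʳ-≈ v²≈0 (≤-respˡ-≈ (+-identityʳ _) (+-mono-≤ ≤-refl (⟨⟩-nonNeg (v ∘ suc)))))
    (0≤x² (v zero)))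
  ⟨v,v⟩≈0⇒v≋0 {suc d} v v²≈0 (suc t) = ⟨v,v⟩≈0⇒v≋0 (v ∘ suc) (≤-antisym
    (≤-respʳ-≈ v²≈0 (≤-respˡ-≈ (+-identityˡ _) (+-mono-≤ (0≤x² (v zero)) ≤-refl)))
    (⟨⟩-nonNeg (v ∘ suc))) t

  norm² : ∀ {d} (v : Vector ℝ d) → norm v * norm v ≈ ⟨ v , v ⟩
  norm² v = √x*√x≈x (⟨⟩-nonNeg v)

-- Gram-Schmidt orthogonalisation.

module GramSchmidtProperties (R : CompleteOrderedField) {r d : ℕ}
    {b : Vector (Vector (CompleteOrderedField.Carrier R) d) r}
    (GS : Reals.GramSchmidt R b) where
  open Reals R hiding (zero)
  open OrderedField R
  open Sums R
  open InnerProduct R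
  open GramSchmidt GS
  open ≤-Reasoning

  -- `GramSchmidt` says nothing about `coeff i j` unless j < i. Cutting off the other entries makes
  -- the subtracted sum a `linearCombination`, so that the inner product rules apply to it.
  lower : Fin r → Vector ℝ r
  lower i j = if does (j Fin.<? i) then coeff i j else 0#

  lower-< : ∀ {i j} → j Fin.< i → lower i j ≈ coeff i j
  lower-< {i} {j} j<i =
    reflexive (≡.cong (if_then coeff i j else 0#) (dec-true (j Fin.<? i) j<i))

  lower-≮ : ∀ {i j} → ¬ (j Fin.< i) → lower i j ≈ 0#
  lower-≮ {i} {j} j≮i =
    reflexive (≡.cong (if_then coeff i j else 0#) (dec-false (j Fin.<? i) j≮i))

  b≋b*+lower : ∀ i → b i ≋ λ t → b* i t + 1# * linearCombination (lower i) b* t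
  b≋b*+lower i t = begin-equality
    b i t                                                     ≈⟨ solve 2 (λ u s → u := (u :- s) :+ s) refl (b i t) s ⟩
    (b i t - s) + s                                           ≈⟨ +-cong (sym (b*≋ i t)) (sum-cong λ j → if-* (does (j Fin.<? i)) (coeff i j) (b* j t)) ⟩
    b* i t + linearCombination (lower i) b* t                 ≈⟨ +-congˡ (*-identityˡ _) ⟨
    b* i t + 1# * linearCombination (lower i) b* t            ∎
    where
    s = sum (λ j → if does (j Fin.<? i) then coeff i j * b* j t else 0#)
    if-* : ∀ c x y → (if c then x * y else 0#) ≈ (if c then x else 0#) * y
    if-* true  x y = refl
    if-* false x y = sym (zeroˡ y)

  ⟨b,w⟩ : ∀ i w → ⟨ b i , w ⟩ ≈ ⟨ b* i , w ⟩ + sum (λ j → lower i j * ⟨ b* j , w ⟩)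
  ⟨b,w⟩ i w = begin-equality
    ⟨ b i , w ⟩                                                ≈⟨ ⟨⟩-cong (b≋b*+lower i) (λ _ → refl) ⟩
    _                                                          ≈⟨ ⟨⟩-linear (b* i) (linearCombination (lower i) b*) w 1# ⟩
    ⟨ b* i , w ⟩ + 1# * ⟨ linearCombination (lower i) b* , w ⟩ ≈⟨ +-congˡ (trans (*-identityˡ _) (⟨⟩-lc (lower i) b* w)) ⟩
    ⟨ b* i , w ⟩ + sum (λ j → lower i j * ⟨ b* j , w ⟩)        ∎

  -- The formula for `coeff` with its denominator cleared. If `⟨ b* j , b* j ⟩` is 0, then `b* j` is
  -- the zero vector and both sides vanish.
  coeff*‖b*‖² : ∀ i j → j Fin.< i → coeff i j * ⟨ b* j , b* j ⟩ ≈ ⟨ b i , b* j ⟩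
  coeff*‖b*‖² i j j<i with ⟨ b* j , b* j ⟩ ≟ 0#
  ... | yes B≈0 = begin-equality
    coeff i j * ⟨ b* j , b* j ⟩  ≈⟨ trans (*-congˡ B≈0) (zeroʳ _) ⟩
    0#                           ≈⟨ sum-≈0 (λ t → trans (*-congˡ (⟨v,v⟩≈0⇒v≋0 (b* j) B≈0 t)) (zeroʳ _)) ⟨
    ⟨ b i , b* j ⟩               ∎
  ... | no B≉0 = begin-equality
    coeff i j * B                     ≈⟨ *-congʳ (coeff≈ i j j<i) ⟩
    ⟨ b i , b* j ⟩ * B ⁻¹ * B         ≈⟨ solve 3 (λ p q B → p :* q :* B := (B :* q) :* p) refl _ _ B ⟩
    (B * B ⁻¹) * ⟨ b i , b* j ⟩       ≈⟨ trans (*-congʳ (*-inverseʳ B≉0)) (*-identityˡ _) ⟩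
    ⟨ b i , b* j ⟩                    ∎
    where B = ⟨ b* j , b* j ⟩

  -- Strong induction on the larger index. Expand `⟨ b i , b* j ⟩` by `⟨b,w⟩`: among the terms with
  -- k < i only k = j survives, and by the choice of `coeff` it already equals `⟨ b i , b* j ⟩`,
  -- leaving 0 for `⟨ b* i , b* j ⟩`.
  orthogonal-< : ∀ i j → j Fin.< i → ⟨ b* i , b* j ⟩ ≈ 0#
  orthogonal-< i j = <-rec
    (λ n → ∀ i → toℕ i ≡ n → ∀ j → j Fin.< i → ⟨ b* i , b* j ⟩ ≈ 0#) step (toℕ i) i ≡.refl j
    where
    step : ∀ n → (∀ {m} → m ℕ.< n → ∀ i → toℕ i ≡ m → ∀ j → j Fin.< i → ⟨ b* i , b* j ⟩ ≈ 0#) →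
           ∀ i → toℕ i ≡ n → ∀ j → j Fin.< i → ⟨ b* i , b* j ⟩ ≈ 0#
    step _ IH i ≡.refl j j<i = begin-equality
      ⟨ b* i , b* j ⟩                      ≈⟨ solve 2 (λ u s → u := (u :+ s) :- s) refl ⟨ b* i , b* j ⟩ s ⟩
      (⟨ b* i , b* j ⟩ + s) - s            ≈⟨ +-cong (sym (⟨b,w⟩ i (b* j))) (-‿cong s≈) ⟩
      ⟨ b i , b* j ⟩ - ⟨ b i , b* j ⟩      ≈⟨ -‿inverseʳ _ ⟩
      0#                                   ∎
      where
      s = sum (λ k → lower i k * ⟨ b* k , b* j ⟩)
      -- For k < j the induction hypothesis is applied to the pair (j, k), for j < k to the pair (k,
      -- j). In both the larger index is below i.
      others : ∀ k → ¬ (k ≡ j) → lower i k * ⟨ b* k , b* j ⟩ ≈ 0#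
      others k k≢j with k Fin.<? i
      ... | no k≮i = trans (*-congʳ (lower-≮ k≮i)) (zeroˡ _)
      ... | yes k<i with Fin.<-cmp k j
      ...   | tri< k<j _ _ = trans (*-congˡ (trans (⟨⟩-comm (b* k) (b* j)) (IH j<i j ≡.refl k k<j))) (zeroʳ _)
      ...   | tri≈ _ k≡j _ = contradiction k≡j k≢j
      ...   | tri> _ _ j<k = trans (*-congˡ (IH k<i k ≡.refl j j<k)) (zeroʳ _)
      s≈ : s ≈ ⟨ b i , b* j ⟩
      s≈ = trans (sum-single _ j others)
        (trans (*-congʳ (lower-< j<i)) (coeff*‖b*‖² i j j<i))

  orthogonal : ∀ i j → ¬ (i ≡ j) → ⟨ b* i , b* j ⟩ ≈ 0#
  orthogonal i j i≢j with Fin.<-cmp i j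
  ... | tri< i<j _ _ = trans (⟨⟩-comm (b* i) (b* j)) (orthogonal-< j i i<j)
  ... | tri≈ _ i≡j _ = contradiction i≡j i≢j
  ... | tri> _ _ j<i = orthogonal-< i j j<i

  -- `b i` is `b* i` plus a combination of earlier `b* k`, all of which are orthogonal to `b* j`
  -- since k < i ≤ j.
  ⟨b,b*⟩ : ∀ i j → i Fin.≤ j → ⟨ b i , b* j ⟩ ≈ ⟨ b* i , b* j ⟩
  ⟨b,b*⟩ i j i≤j = trans (⟨b,w⟩ i (b* j)) (trans (+-congˡ (sum-≈0 vanishes)) (+-identityʳ _))
    where
    vanishes : ∀ k → lower i k * ⟨ b* k , b* j ⟩ ≈ 0#
    vanishes k with k Fin.<? i
    ... | no  k≮i = trans (*-congʳ (lower-≮ k≮i)) (zeroˡ _)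
    ... | yes k<i = trans (*-congˡ (orthogonal k j (Fin.<⇒≢ (ℕ.<-≤-trans k<i i≤j)))) (zeroʳ _)

  -- Triangularity from both sides: terms above l have coefficient 0, and `b i` with i < l is
  -- orthogonal to `b* l`.
  ⟨lc,b*⟩ : ∀ a l → (∀ i → l Fin.< i → a i ≈ 0#) →
    ⟨ linearCombination a b , b* l ⟩ ≈ a l * ⟨ b* l , b* l ⟩
  ⟨lc,b*⟩ a l a≈0 = trans (⟨⟩-lc a b (b* l))
    (trans (sum-single _ l others) (*-congˡ (⟨b,b*⟩ l l ℕ.≤-refl)))
    where
    others : ∀ i → ¬ (i ≡ l) → a i * ⟨ b i , b* l ⟩ ≈ 0#
    others i i≢l with Fin.<-cmp i l
    ... | tri< i<l _ _ = trans (*-congˡ (trans (⟨b,b*⟩ i l (ℕ.<⇒≤ i<l)) (orthogonal i l i≢l))) (zeroʳ _)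
    ... | tri≈ _ i≡l _ = contradiction i≡l i≢l
    ... | tri> _ _ l<i = trans (*-congʳ (a≈0 i l<i)) (zeroˡ _)

  -- The component of v along b* l has length a l ‖b* l‖.
  ‖b*‖²≤‖v‖² : ∀ a l → (∀ i → l Fin.< i → a i ≈ 0#) → 1# ≤ a l * a l →
    let v = linearCombination a b in ⟨ b* l , b* l ⟩ ≤ ⟨ v , v ⟩
  ‖b*‖²≤‖v‖² a l a≈0 1≤aₗ² = begin
    B                    ≈⟨ *-identityʳ B ⟨
    B * 1#               ≤⟨ *-monoʳ-≤ (⟨⟩-nonNeg (b* l)) 1≤aₗ² ⟩
    B * (aₗ * aₗ)        ≤⟨ 0≤y-x⇒x≤y (≤-respʳ-≈ expand (⟨⟩-nonNeg w)) ⟩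
    ⟨ v , v ⟩            ∎
    where
    v = linearCombination a b
    B = ⟨ b* l , b* l ⟩
    aₗ = a l
    -- This is `v` with the multiple aₗ of `b* l` removed. Nonnegativity of `⟨ w , w ⟩` is Bessel's
    -- inequality for a single vector, stated without division.
    w = λ t → v t + (- aₗ) * b* l t
    expand : ⟨ w , w ⟩ ≈ ⟨ v , v ⟩ - B * (aₗ * aₗ)
    expand = begin-equality
      ⟨ w , w ⟩  ≈⟨ ⟨⟩-expand v (b* l) (- aₗ) ⟩
      ⟨ v , v ⟩ + fromℕ 2 * (- aₗ * ⟨ v , b* l ⟩) + - aₗ * - aₗ * B
                 ≈⟨ +-congʳ (+-congˡ (*-congˡ (*-congˡ (⟨lc,b*⟩ a l a≈0)))) ⟩
      ⟨ v , v ⟩ + fromℕ 2 * (- aₗ * (aₗ * B)) + - aₗ * - aₗ * B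
                 ≈⟨ solve 3 (λ V a B → V :+ con (+ 2) :* (:- a :* (a :* B)) :+ :- a :* :- a :* B
                              := V :- B :* (a :* a)) refl ⟨ v , v ⟩ aₗ B ⟩
      ⟨ v , v ⟩ - B * (aₗ * aₗ)  ∎

-- Bounds for LLL-reduced bases.

module LLLProperties (R : CompleteOrderedField) {r d : ℕ}
    {b : Vector (Vector (CompleteOrderedField.Carrier R) d) (suc r)}
    (reduced : Reals.IsLLLReduced R b) where
  open Reals R hiding (zero)
  open OrderedField R
  open Sums R
  open InnerProduct R
  open IsLLLReduced reduced
  open GramSchmidtProperties R gramSchmidt
  open ≤-Reasoning

  B : Fin (suc r) → ℝ
  B i = ⟨ b* i , b* i ⟩

  x²≤y² : ∀ {x y} → ∣ x ∣ ≤ y → x * x ≤ y * y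
  x²≤y² {x} {y} ∣x∣≤y = 0≤y-x⇒x≤y (begin
    0#                 ≤⟨ *-nonNeg (x≤y⇒0≤y-x (≤-trans (x≤x⊔y x (- x)) ∣x∣≤y))
                                   (x≤y⇒0≤y-x (≤-trans (x≤y⊔x x (- x)) ∣x∣≤y)) ⟩
    (y - x) * (y - - x)  ≈⟨ solve 2 (λ x y → (y :- x) :* (y :- :- x) := y :* y :- x :* x) refl x y ⟩
    y * y - x * x      ∎)

  -- By orthogonality the Lovász condition reads (3/4) Bⱼ ≤ Bᵢ + μ² Bⱼ, and size reduction gives μ²
  -- ≤ 1/4. Hence Bⱼ / 2 ≤ Bᵢ. The calculation is scaled by 4, after which Bⱼ and then a factor 2
  -- are cancelled.
  B-step : ∀ i j → toℕ i ≡ suc (toℕ j) → B j ≤ fromℕ 2 * B i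
  B-step i j i≡1+j = *-cancelˡ-≤ (0<fromℕ 2) (+-cancelʳ-≤ (B j) (begin
    two * B j + B j                    ≈⟨ solve 1 (λ B → con (+ 2) :* B :+ B := con (+ 3) :* (con (+ 1) :* B)) refl (B j) ⟩
    fromℕ 3 * (fromℕ 1 * B j)          ≈⟨ *-congˡ (*-congʳ (trans (*-inverseʳ-pos (0<fromℕ 4)) (sym (+-identityʳ 1#)))) ⟨
    fromℕ 3 * (four * four ⁻¹ * B j)   ≈⟨ solve 2 (λ q B → con (+ 3) :* (con (+ 4) :* q :* B)
                                            := con (+ 4) :* (con (+ 3) :* q :* B)) refl (four ⁻¹) (B j) ⟩
    four * (fromℕ 3 * four ⁻¹ * B j)   ≤⟨ *-monoʳ-≤ (0≤fromℕ 4) (lovász i j i≡1+j) ⟩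
    four * ⟨ w , w ⟩                   ≈⟨ *-congˡ (⟨⟩-expand (b* i) (b* j) μ) ⟩
    four * (B i + two * (μ * ⟨ b* i , b* j ⟩) + μ * μ * B j)
                                       ≈⟨ *-congˡ (+-congʳ (+-congˡ (*-congˡ (*-congˡ (orthogonal-< i j j<i))))) ⟩
    four * (B i + two * (μ * 0#) + μ * μ * B j)
                                       ≈⟨ solve 3 (λ Bi Bj μ → con (+ 4) :* (Bi :+ con (+ 2) :* (μ :* con 0ℤ) :+ μ :* μ :* Bj)
                                            := con (+ 4) :* Bi :+ con (+ 4) :* (Bj :* (μ :* μ)))
                                            refl (B i) (B j) μ ⟩
    four * B i + four * (B j * (μ * μ))  ≤⟨ +-mono-≤ ≤-refl (*-monoʳ-≤ (0≤fromℕ 4)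
                                            (*-monoʳ-≤ (⟨⟩-nonNeg (b* j)) (x²≤y² (sizeReduced i j j<i)))) ⟩
    four * B i + four * (B j * (two ⁻¹ * two ⁻¹))
                                       ≈⟨ solve 3 (λ Bi Bj p → con (+ 4) :* Bi :+ con (+ 4) :* (Bj :* (p :* p))
                                            := con (+ 2) :* (con (+ 2) :* Bi) :+ (con (+ 2) :* p) :* (con (+ 2) :* p) :* Bj)
                                            refl (B i) (B j) (two ⁻¹) ⟩
    two * (two * B i) + (two * two ⁻¹) * (two * two ⁻¹) * B j
                                       ≈⟨ +-congˡ (*-congʳ (*-cong 2*½ 2*½)) ⟩
    two * (two * B i) + 1# * 1# * B j  ≈⟨ +-congˡ (trans (*-congʳ (*-identityˡ 1#)) (*-identityˡ (B j))) ⟩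
    two * (two * B i) + B j            ∎))
    where
    two = fromℕ 2
    four = fromℕ 4
    μ = coeff i j
    w = λ t → b* i t + μ * b* j t
    j<i : j Fin.< i
    j<i = ℕ.≤-reflexive (≡.sym i≡1+j)
    2*½ : two * two ⁻¹ ≈ 1#
    2*½ = *-inverseʳ-pos (0<fromℕ 2)

  B₀≤2ⁱBᵢ : ∀ i → B zero ≤ fromℕ (2 ℕ.^ toℕ i) * B i
  B₀≤2ⁱBᵢ = <-weakInduction _ (≤-reflexive (sym (trans (*-congʳ (+-identityʳ 1#)) (*-identityˡ _)))) step
    where
    step : ∀ i → B zero ≤ fromℕ (2 ℕ.^ toℕ (inject₁ i)) * B (inject₁ i) →
           B zero ≤ fromℕ (2 ℕ.^ suc (toℕ i)) * B (suc i)
    step i IH = begin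
      B zero                                           ≤⟨ IH ⟩
      fromℕ (2 ℕ.^ toℕ (inject₁ i)) * B (inject₁ i)    ≡⟨ ≡.cong (λ n → fromℕ (2 ℕ.^ n) * B (inject₁ i)) (Fin.toℕ-inject₁ i) ⟩
      fromℕ (2 ℕ.^ toℕ i) * B (inject₁ i)              ≤⟨ *-monoʳ-≤ (0≤fromℕ (2 ℕ.^ toℕ i))
                                                            (B-step (suc i) (inject₁ i) (≡.cong suc (≡.sym (Fin.toℕ-inject₁ i)))) ⟩
      fromℕ (2 ℕ.^ toℕ i) * (fromℕ 2 * B (suc i))      ≈⟨ solve 3 (λ p q B → p :* (q :* B) := q :* p :* B) refl _ (fromℕ 2) _ ⟩
      fromℕ 2 * fromℕ (2 ℕ.^ toℕ i) * B (suc i)        ≈⟨ *-congʳ (×1-homo-* 2 (2 ℕ.^ toℕ i)) ⟨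
      fromℕ (2 ℕ.* 2 ℕ.^ toℕ i) * B (suc i)            ∎

  -- The basis has `suc r` vectors, so the last index with a nonzero coefficient is at most `r`, and
  -- 2^l can be replaced by 2^r. The chain starts at `b zero` because `b* zero` has nothing to
  -- subtract.
  firstVector-bound : ∀ (z : Vector ℤ (suc r)) → ¬ (∀ i → z i ≡ 0ℤ) →
    let v = linearCombination (fromℤ ∘ z) b in
    ⟨ b zero , b zero ⟩ ≤ fromℕ (2 ℕ.^ r) * ⟨ v , v ⟩
  firstVector-bound z z≢0 with lastNonzero z z≢0
  ... | l , zₗ≢0 , above = begin
    ⟨ b zero , b zero ⟩              ≈⟨ ⟨⟩-cong b₀≋b*₀ b₀≋b*₀ ⟩
    B zero                           ≤⟨ B₀≤2ⁱBᵢ l ⟩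
    fromℕ (2 ℕ.^ toℕ l) * B l        ≤⟨ *-mono-≤ (0≤fromℕ (2 ℕ.^ r)) (⟨⟩-nonNeg (b* l))
                                          (fromℕ-mono-≤ (ℕ.^-monoʳ-≤ 2 (Fin.toℕ≤pred[n] l)))
                                          (‖b*‖²≤‖v‖² (fromℤ ∘ z) l (λ i l<i → reflexive (≡.cong fromℤ (above i l<i)))
                                            (1≤fromℤ² (z l) zₗ≢0)) ⟩
    fromℕ (2 ℕ.^ r) * ⟨ v , v ⟩      ∎
    where
    v = linearCombination (fromℤ ∘ z) b
    b₀≋b*₀ : b zero ≋ b* zero
    b₀≋b*₀ t = trans (b≋b*+lower zero t)
      (trans (+-congˡ (trans (*-identityˡ _) (sum-≈0 λ j → trans (*-congʳ (lower-≮ {zero} {j} λ ())) (zeroˡ (b* j t)))))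
        (+-identityʳ _))

∣x∣≤maxAbs : ∀ {r} (x : Vector ℤ r) l → ℤ.∣ x l ∣ ℕ.≤ maxAbs x
∣x∣≤maxAbs x zero    = ℕ.m≤m⊔n _ _
∣x∣≤maxAbs x (suc l) = ℕ.≤-trans (∣x∣≤maxAbs (x ∘ suc) l) (ℕ.m≤n⊔m ℤ.∣ x zero ∣ _)

-- Passes from 2m as written in the theorem to the rank m + m. For m = `suc k` the exponent on the
-- right computes to `k + m`.
[2m+1]2^[2m∸1]≡ : ∀ m → (2 ℕ.* m ℕ.+ 1) ℕ.* 2 ℕ.^ (2 ℕ.* m ℕ.∸ 1) ≡
  2 ℕ.^ (m ℕ.+ m ℕ.∸ 1) ℕ.* suc (m ℕ.+ m)
[2m+1]2^[2m∸1]≡ m rewrite ℕ.+-identityʳ m | ℕ.+-comm (m ℕ.+ m) 1 =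
  ℕ.*-comm (suc (m ℕ.+ m)) (2 ℕ.^ (m ℕ.+ m ℕ.∸ 1))

-- Real and imaginary parts of integer combinations.

module ComplexSums (R : CompleteOrderedField) where
  open Reals R hiding (zero)
  open OrderedField R
  open Sums R
  open ≤-Reasoning

  Re-fromℕ : ∀ n → Re (ℂ-Ring.fromℕ n) ≈ fromℕ n
  Re-fromℕ zero    = refl
  Re-fromℕ (suc n) = +-congˡ (Re-fromℕ n)

  Re-fromℤ : ∀ z → Re (ℂ-Ring.fromℤ z) ≈ fromℤ z
  Re-fromℤ (+ n)    = Re-fromℕ n
  Re-fromℤ -[1+ n ] = -‿cong (Re-fromℕ (suc n))

  Im-fromℕ : ∀ n → Im (ℂ-Ring.fromℕ n) ≈ 0#
  Im-fromℕ zero    = refl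
  Im-fromℕ (suc n) = trans (+-identityˡ _) (Im-fromℕ n)

  Im-fromℤ : ∀ z → Im (ℂ-Ring.fromℤ z) ≈ 0#
  Im-fromℤ (+ n)    = Im-fromℕ n
  Im-fromℤ -[1+ n ] = trans (-‿cong (Im-fromℕ (suc n)))
    (solve 0 (:- con 0ℤ := con 0ℤ) refl)

  Re-sum : ∀ {r} (e : Vector ℂ r) (x : Vector ℤ r) →
    Re (ℂ-Ring.sum (λ l → e l ℂ-Ring.* ℂ-Ring.fromℤ (x l))) ≈ sum (λ l → fromℤ (x l) * Re (e l))
  Re-sum {zero}  e x = refl
  Re-sum {suc r} e x = +-cong (begin-equality
    Re e₀ * Re x₀ - Im e₀ * Im x₀         ≈⟨ +-cong (*-congˡ (Re-fromℤ (x zero)))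
                                               (-‿cong (*-congˡ (Im-fromℤ (x zero)))) ⟩
    Re e₀ * fromℤ (x zero) - Im e₀ * 0#   ≈⟨ solve 3 (λ p q z → p :* z :- q :* con 0ℤ := z :* p)
                                               refl (Re e₀) (Im e₀) (fromℤ (x zero)) ⟩
    fromℤ (x zero) * Re e₀                ∎) (Re-sum (e ∘ suc) (x ∘ suc))
    where
    e₀ = e zero
    x₀ = ℂ-Ring.fromℤ (x zero)

  Im-sum : ∀ {r} (e : Vector ℂ r) (x : Vector ℤ r) →
    Im (ℂ-Ring.sum (λ l → e l ℂ-Ring.* ℂ-Ring.fromℤ (x l))) ≈ sum (λ l → fromℤ (x l) * Im (e l))
  Im-sum {zero}  e x = refl
  Im-sum {suc r} e x = +-cong (begin-equality
    Re e₀ * Im x₀ + Im e₀ * Re x₀         ≈⟨ +-cong (*-congˡ (Im-fromℤ (x zero)))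
                                               (*-congˡ (Re-fromℤ (x zero))) ⟩
    Re e₀ * 0# + Im e₀ * fromℤ (x zero)   ≈⟨ solve 3 (λ p q z → p :* con 0ℤ :+ q :* z := z :* q)
                                               refl (Re e₀) (Im e₀) (fromℤ (x zero)) ⟩
    fromℤ (x zero) * Im e₀                ∎) (Im-sum (e ∘ suc) (x ∘ suc))
    where
    e₀ = e zero
    x₀ = ℂ-Ring.fromℤ (x zero)

  modulus² : ∀ z → modulus z * modulus z ≈ Re z * Re z + Im z * Im z
  modulus² z = √x*√x≈x (+-nonNeg (0≤x² (Re z)) (0≤x² (Im z)))

  0≤modulus : ∀ z → 0# ≤ modulus z
  0≤modulus z = 0≤root 2 _

-- Lattices generated by an identity matrix with two extra rows.

module ExtendedIdentity (R : CompleteOrderedField) where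
  open Reals R hiding (zero)
  open OrderedField R
  open Sums R
  open ≤-Reasoning

  -- An abstract form of `column`, which is the instance where `p` and `q` are the real and
  -- imaginary parts of the entries. The norm computation thus stays clear of the number field.
  generator : ∀ {r} → ℝ → (p q : Vector ℝ r) → Vector (Vector ℝ (r ℕ.+ 2)) r
  generator H p q l = (λ t → if does (t Fin.≟ l) then 1# else 0#) ++ (H * p l ∷ H * q l ∷ [])

  module _ {r} (H : ℝ) (p q : Vector ℝ r) (a : Vector ℝ r) where
    v : Vector ℝ (r ℕ.+ 2)
    v = linearCombination a (generator H p q)

    -- The identity block makes a lattice vector remember its coefficients. This serves the norm as
    -- well as the proof that the coefficients in the reduced basis are not all zero.
    v-↑ˡ : ∀ t → v (t ↑ˡ 2) ≈ a t
    v-↑ˡ t = begin-equality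
      sum (λ l → a l * generator H p q l (t ↑ˡ 2))     ≈⟨ sum-cong (λ l → *-congˡ (reflexive (lookup-++ˡ (δ l) _ t))) ⟩
      sum (λ l → a l * δ l t)                          ≈⟨ sum-single _ t (λ l l≢t → trans
                                                            (*-congˡ (reflexive (≡.cong (if_then 1# else 0#)
                                                              (dec-false (t Fin.≟ l) (l≢t ∘ ≡.sym)))))
                                                            (zeroʳ (a l))) ⟩
      a t * δ t t                                      ≈⟨ *-congˡ (reflexive (≡.cong (if_then 1# else 0#)
                                                            (dec-true (t Fin.≟ t) ≡.refl))) ⟩
      a t * 1#                                         ≈⟨ *-identityʳ (a t) ⟩
      a t                                              ∎
      where
      δ : Fin r → Vector ℝ r
      δ l t = if does (t Fin.≟ l) then 1# else 0#

    v-↑ʳ : ∀ j → v (r ↑ʳ j) ≈ H * sum (λ l → a l * (p l ∷ q l ∷ []) j)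
    v-↑ʳ j = begin-equality
      sum (λ l → a l * generator H p q l (r ↑ʳ j))       ≈⟨ sum-cong (λ l → trans
                                                              (*-congˡ (trans (reflexive (lookup-++ʳ {m = r} _ (H * p l ∷ H * q l ∷ []) j)) (scale l j)))
                                                              (solve 3 (λ a H s → a :* (H :* s) := H :* (a :* s))
                                                                refl (a l) H ((p l ∷ q l ∷ []) j))) ⟩
      sum (λ l → H * (a l * (p l ∷ q l ∷ []) j))         ≈⟨ *-distribˡ-sum H (λ l → a l * (p l ∷ q l ∷ []) j) ⟨
      H * sum (λ l → a l * (p l ∷ q l ∷ []) j)           ∎
      where
      scale : ∀ l j → (H * p l ∷ H * q l ∷ []) j ≈ H * (p l ∷ q l ∷ []) j
      scale l zero       = refl
      scale l (suc zero) = refl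

    ⟨v,v⟩ : ⟨ v , v ⟩ ≈ sum (λ t → a t * a t) +
      H * H * (sum (λ l → a l * p l) * sum (λ l → a l * p l) + sum (λ l → a l * q l) * sum (λ l → a l * q l))
    ⟨v,v⟩ = trans (sum-↑ r (λ t → v t * v t))
      (+-cong (sum-cong λ t → *-cong (v-↑ˡ t) (v-↑ˡ t))
        (trans (+-cong (*-cong (v-↑ʳ zero) (v-↑ʳ zero))
                 (+-congʳ (*-cong (v-↑ʳ (suc zero)) (v-↑ʳ (suc zero)))))
          (solve 3 (λ H P Q → H :* P :* (H :* P) :+ (H :* Q :* (H :* Q) :+ con 0ℤ)
                            := H :* H :* (P :* P :+ Q :* Q)) refl H
            (sum (λ l → a l * p l)) (sum (λ l → a l * q l)))))

-- The lattice vector attached to a solution.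

module Reduction {c ℓ c′ ℓ′ : Level} (R : CompleteOrderedField) {k n : ℕ}
    (E : Setting R c ℓ c′ ℓ′ k n) (h : Fin (suc k)) (i : Fin n) where
  open Reals R hiding (zero)
  open Constants E
  open Setting E using (S; αᶜ)
  open OrderedField R
  open Sums R
  open ComplexSums R
  open ExtendedIdentity R
  open InnerProduct R
  open ≤-Reasoning

  m = suc k
  r = m ℕ.+ m

  entries : Vector ℂ r
  entries = S h ++ (αᶜ h i ℂ-Ring.*_) ∘ S h

  coefficients : (x y : Vector ℤ m) → Vector ℤ r
  coefficients x y = x ++ ℤ.-_ ∘ y

  -- Serves the row of real parts and the row of imaginary parts alike. The minus signs sit on the
  -- integers, so additivity of `π` is not involved.
  sum-entries : (π : ℂ → ℝ) (x y : Vector ℤ m) →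
    sum (λ l → fromℤ (coefficients x y l) * π (entries l)) ≈
    sum (λ l → fromℤ (x l) * π (S h l)) - sum (λ l → fromℤ (y l) * π (αᶜ h i ℂ-Ring.* S h l))
  sum-entries π x y = begin-equality
    sum (λ l → fromℤ (coefficients x y l) * π (entries l))  ≈⟨ sum-↑ m (λ l → fromℤ (coefficients x y l) * π (entries l)) ⟩
    sum (λ (l : Fin m) → fromℤ (coefficients x y (l ↑ˡ m)) * π (entries (l ↑ˡ m))) +
    sum (λ (l : Fin m) → fromℤ (coefficients x y (m ↑ʳ l)) * π (entries (m ↑ʳ l)))
      ≈⟨ +-cong
          (sum-cong λ l → reflexive (≡.cong₂ (λ z e → fromℤ z * π e)
            (lookup-++ˡ x (ℤ.-_ ∘ y) l) (lookup-++ˡ (S h) ((αᶜ h i ℂ-Ring.*_) ∘ S h) l)))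
          (sum-cong λ l → trans (reflexive (≡.cong₂ (λ z e → fromℤ z * π e)
            (lookup-++ʳ x (ℤ.-_ ∘ y) l) (lookup-++ʳ (S h) ((αᶜ h i ℂ-Ring.*_) ∘ S h) l)))
            (trans (*-congʳ (fromℤ-neg (y l)))
              (solve 2 (λ y e → :- y :* e := con (ℤ.- + 1) :* (y :* e)) refl (fromℤ (y l)) (e l)))) ⟩
    P + sum (λ l → fromℤ (ℤ.- + 1) * (fromℤ (y l) * e l))    ≈⟨ +-congˡ (*-distribˡ-sum (fromℤ (ℤ.- + 1)) (λ l → fromℤ (y l) * e l)) ⟨
    P + fromℤ (ℤ.- + 1) * Q                                  ≈⟨ solve 2 (λ P Q → P :+ con (ℤ.- + 1) :* Q := P :- Q) refl P Q ⟩
    P - Q                                                    ∎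
    where
    e : Vector ℝ m
    e l = π (αᶜ h i ℂ-Ring.* S h l)
    P = sum (λ l → fromℤ (x l) * π (S h l))
    Q = sum (λ l → fromℤ (y l) * e l)

  module _ (H : ℝ) (x y : Vector ℤ m) where
    z : Vector ℤ r
    z = coefficients x y

    latticeVector : Vector ℝ (r ℕ.+ 2)
    latticeVector = linearCombination (fromℤ ∘ z) (column h i H)

    ‖latticeVector‖² : ⟨ latticeVector , latticeVector ⟩ ≈
      sum (λ t → fromℤ (z t) * fromℤ (z t)) +
      (H * modulus (linearForm h i x y)) * (H * modulus (linearForm h i x y))
    ‖latticeVector‖² = begin-equality
      ⟨ latticeVector , latticeVector ⟩      ≈⟨ ⟨v,v⟩ H (Re ∘ entries) (Im ∘ entries) (fromℤ ∘ z) ⟩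
      N + H * H * (P * P + Q * Q)            ≈⟨ +-congˡ (*-congˡ (+-cong (*-cong P≈ P≈) (*-cong Q≈ Q≈))) ⟩
      N + H * H * (Re Λ * Re Λ + Im Λ * Im Λ) ≈⟨ +-congˡ (*-congˡ (modulus² Λ)) ⟨
      N + H * H * (modulus Λ * modulus Λ)    ≈⟨ solve 3 (λ N H M → N :+ H :* H :* (M :* M) := N :+ (H :* M) :* (H :* M))
                                                  refl N H (modulus Λ) ⟩
      N + (H * modulus Λ) * (H * modulus Λ)  ∎
      where
      Λ = linearForm h i x y
      N = sum (λ t → fromℤ (z t) * fromℤ (z t))
      P = sum (λ l → fromℤ (z l) * Re (entries l))
      Q = sum (λ l → fromℤ (z l) * Im (entries l))
      P≈ : P ≈ Re Λ
      P≈ = trans (sum-entries Re x y)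
        (sym (+-cong (Re-sum (S h) x) (-‿cong (Re-sum ((αᶜ h i ℂ-Ring.*_) ∘ S h) y))))
      Q≈ : Q ≈ Im Λ
      Q≈ = trans (sum-entries Im x y)
        (sym (+-cong (Im-sum (S h) x) (-‿cong (Im-sum ((αᶜ h i ℂ-Ring.*_) ∘ S h) y))))

    z≢0 : ¬ (∀ l → x l ≡ 0ℤ × y l ≡ 0ℤ) → ¬ (∀ l → z l ≡ 0ℤ)
    z≢0 xy≢0 z≡0 = xy≢0 λ l →
      ≡.trans (≡.sym (lookup-++ˡ x (ℤ.-_ ∘ y) l)) (z≡0 (l ↑ˡ m)) ,
      ℤ.neg-injective (≡.trans (≡.sym (lookup-++ʳ x (ℤ.-_ ∘ y) l)) (z≡0 (m ↑ʳ l)))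

    ∣z∣≤ : ∀ l → ℤ.∣ z l ∣ ℕ.≤ maxAbs x ℕ.⊔ maxAbs y
    ∣z∣≤ l with splitAt m l
    ... | inj₁ l′ = ℕ.≤-trans (∣x∣≤maxAbs x l′) (ℕ.m≤m⊔n _ _)
    ... | inj₂ l′ = ≡.subst (ℕ._≤ maxAbs x ℕ.⊔ maxAbs y) (≡.sym (ℤ.∣-i∣≡∣i∣ (y l′)))
      (ℕ.≤-trans (∣x∣≤maxAbs y l′) (ℕ.m≤n⊔m (maxAbs x) _))

    ‖b₀‖²≤ : {b : Vector (Vector ℝ (r ℕ.+ 2)) r} →
      IsLatticeBasis (Lattice (column h i H)) b → IsLLLReduced b →
      ¬ (∀ l → z l ≡ 0ℤ) →
      ⟨ b zero , b zero ⟩ ≤ fromℕ (2 ℕ.^ (k ℕ.+ m)) * ⟨ latticeVector , latticeVector ⟩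
    ‖b₀‖²≤ {b} basis reduced z≢0
      with w , v≋ ← IsLatticeBasis.generates basis latticeVector (z , λ _ → refl) = begin
        ⟨ b zero , b zero ⟩                              ≤⟨ firstVector-bound w (w≢0 v≋) ⟩
        _                                                ≈⟨ *-congˡ (⟨⟩-cong v≋ v≋) ⟨
        fromℕ (2 ℕ.^ (k ℕ.+ m)) * ⟨ latticeVector , latticeVector ⟩  ∎
      where
      open LLLProperties R reduced using (firstVector-bound)
      -- If all `w j` were 0, the lattice vector would be 0, but its coordinate at `l` is the
      -- nonzero integer `z l`, whose square is at least 1.
      w≢0 : ∀ {w} → latticeVector ≋ linearCombination (fromℤ ∘ w) b → ¬ (∀ j → w j ≡ 0ℤ)
      w≢0 {w} v≋ w≡0 with l , zₗ≢0 , _ ← lastNonzero z z≢0 = 1≉0 (≤-antisym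
        (begin
          1#                         ≤⟨ 1≤fromℤ² (z l) zₗ≢0 ⟩
          fromℤ (z l) * fromℤ (z l)  ≈⟨ *-congʳ (v-↑ˡ H (Re ∘ entries) (Im ∘ entries) (fromℤ ∘ z) l) ⟨
          latticeVector (l ↑ˡ 2) * fromℤ (z l)
                                     ≈⟨ *-congʳ (trans (v≋ (l ↑ˡ 2)) (sum-≈0 λ j →
                                          trans (*-congʳ (reflexive (≡.cong fromℤ (w≡0 j)))) (zeroˡ (b j (l ↑ˡ 2))))) ⟩
          0# * fromℤ (z l)           ≈⟨ zeroˡ _ ⟩
          0#                         ∎)
        0≤1)

-- The final estimate.

theorem3 : {c ℓ c′ ℓ′ : Level} (R : CompleteOrderedField) {k n : ℕ} .{{_ : NonZero (n ℕ.∸ 1)}}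
    (E : Setting R c ℓ c′ ℓ′ k n) →
    let open Reals R
        open Constants E
        m = suc k
    in
    (h : Fin m) (i : Fin n) (H : ℝ) → 0# < H →
    (b : Vector (Vector ℝ ((m ℕ.+ m) ℕ.+ 2)) (m ℕ.+ m)) →
    IsLatticeBasis (Lattice (column h i H)) b →
    IsLLLReduced b →
    (x y : Vector ℤ m) → ¬ (∀ l → x l ≡ 0ℤ × y l ≡ 0ℤ) →
    (A : ℕ) → A ≡ maxAbs x ℕ.⊔ maxAbs y →
    modulus (linearForm h i x y) ≤ d-hi h i * (fromℕ A ^ (n ℕ.∸ 1)) ⁻¹ →
    (A₀ : ℝ) → 0# < A₀ → fromℕ A ≤ A₀ →
    (√ fromℕ ((2 ℕ.* m ℕ.+ 1) ℕ.* 2 ℕ.^ (2 ℕ.* m ℕ.∸ 1))) * A₀ ≤ norm (b Fin.zero) →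
    fromℕ A ≤ root (n ℕ.∸ 1) (d-hi h i * H * A₀ ⁻¹)
theorem3 R {k} {n} E h i H 0<H b basis reduced x y xy≢0 A A≡ Λ≤ A₀ 0<A₀ A≤A₀ large =
  -- It suffices that A^(n-1) ≤ d H / A₀. Multiplied by A₀ this follows from A₀ A^(n-1) ≤ H |Λ|
  -- A^(n-1) ≤ d H.
  xᵏ≤y⇒x≤root (n ℕ.∸ 1) (*-cancelˡ-≤ 0<A₀ (begin
    A₀ * Aⁿ⁻¹                        ≈⟨ *-comm A₀ Aⁿ⁻¹ ⟩
    Aⁿ⁻¹ * A₀                        ≤⟨ *-monoʳ-≤ (proj₁ 0<Aⁿ⁻¹) A₀≤HΛ ⟩
    Aⁿ⁻¹ * (H * modulus Λ)           ≤⟨ *-monoʳ-≤ (proj₁ 0<Aⁿ⁻¹) (*-monoʳ-≤ (proj₁ 0<H) Λ≤) ⟩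
    Aⁿ⁻¹ * (H * (d * Aⁿ⁻¹ ⁻¹))       ≈⟨ solve 4 (λ P H d p → P :* (H :* (d :* p)) := (P :* p) :* (d :* H))
                                          refl Aⁿ⁻¹ H d (Aⁿ⁻¹ ⁻¹) ⟩
    (Aⁿ⁻¹ * Aⁿ⁻¹ ⁻¹) * (d * H)       ≈⟨ *-congʳ (*-inverseʳ-pos 0<Aⁿ⁻¹) ⟩
    1# * (d * H)                     ≈⟨ *-congʳ (*-inverseʳ-pos 0<A₀) ⟨
    (A₀ * A₀ ⁻¹) * (d * H)           ≈⟨ solve 3 (λ A a e → (A :* a) :* e := A :* (e :* a)) refl A₀ (A₀ ⁻¹) (d * H) ⟩
    A₀ * (d * H * A₀ ⁻¹)             ∎))
  where
  open Reals R hiding (zero)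
  open Constants E
  open OrderedField R
  open Sums R
  open InnerProduct R
  open ComplexSums R
  open Reduction R E h i using (m; r; latticeVector; ‖latticeVector‖²; ∣z∣≤; ‖b₀‖²≤)
  open ≤-Reasoning

  Aⁿ⁻¹ = fromℕ A ^ (n ℕ.∸ 1)
  d = d-hi h i
  Λ = linearForm h i x y
  v = latticeVector H x y
  z = Reduction.z R E h i H x y
  z≢0 = Reduction.z≢0 R E h i H x y xy≢0

  ∣z∣≤A : ∀ l → ℤ.∣ z l ∣ ℕ.≤ A
  ∣z∣≤A l = ≡.subst (ℤ.∣ z l ∣ ℕ.≤_) (≡.sym A≡) (∣z∣≤ H x y l)

  -- A nonzero coefficient forces A ≥ 1, so the inverse in the hypothesis on |Λ| is a true inverse
  -- and not the default value 0.
  0<Aⁿ⁻¹ : 0# < Aⁿ⁻¹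
  0<Aⁿ⁻¹ with l , zₗ≢0 , _ ← lastNonzero z z≢0 = 1≤x⇒0<x (1≤x^n (n ℕ.∸ 1)
    (1≤fromℕ A {{ℕ.>-nonZero (ℕ.<-≤-trans (ℕ.n≢0⇒n>0 (zₗ≢0 ∘ ℤ.∣i∣≡0⇒i≡0)) (∣z∣≤A l))}}))

  z²≤A₀² : ∀ l → fromℤ (z l) * fromℤ (z l) ≤ A₀ * A₀
  z²≤A₀² l = ≤-respˡ-≈ (sym (fromℤ² (z l)))
    (*-mono-≤ (proj₁ 0<A₀) (0≤fromℕ ℤ.∣ z l ∣) ∣z∣≤A₀ ∣z∣≤A₀)
    where
    ∣z∣≤A₀ : fromℕ ℤ.∣ z l ∣ ≤ A₀
    ∣z∣≤A₀ = ≤-trans (fromℕ-mono-≤ (∣z∣≤A l)) A≤A₀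

  N = (2 ℕ.* m ℕ.+ 1) ℕ.* 2 ℕ.^ (2 ℕ.* m ℕ.∸ 1)
  T = 2 ℕ.^ (k ℕ.+ m)

  N*A₀²≤‖b₀‖² : fromℕ N * (A₀ * A₀) ≤ ⟨ b zero , b zero ⟩
  N*A₀²≤‖b₀‖² = begin
    fromℕ N * (A₀ * A₀)                    ≈⟨ *-congʳ (√x*√x≈x (0≤fromℕ N)) ⟨
    √ fromℕ N * √ fromℕ N * (A₀ * A₀)      ≈⟨ solve 2 (λ s A → s :* s :* (A :* A) := (s :* A) :* (s :* A)) refl (√ fromℕ N) A₀ ⟩
    (√ fromℕ N * A₀) * (√ fromℕ N * A₀)    ≤⟨ *-mono-≤ (0≤root 2 _) (*-nonNeg (0≤root 2 _) (proj₁ 0<A₀)) large large ⟩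
    norm (b zero) * norm (b zero)          ≈⟨ norm² (b zero) ⟩
    ⟨ b zero , b zero ⟩                    ∎

  A₀≤HΛ : A₀ ≤ H * modulus Λ
  A₀≤HΛ = x²≤y²⇒x≤y (*-nonNeg (proj₁ 0<H) (0≤modulus Λ))
    -- Both sides are first scaled by T = 2^(2m-1) and enlarged by r A₀², to match the lower bound N
    -- A₀² with N = T (r + 1).
    (+-cancelʳ-≤ (fromℕ r * (A₀ * A₀)) (*-cancelˡ-≤ (0<fromℕ T {{ℕ.m^n≢0 2 (k ℕ.+ m)}}) (begin
      fromℕ T * (A₀ * A₀ + fromℕ r * (A₀ * A₀))  ≈⟨ *-congˡ (+-congʳ (*-identityˡ _)) ⟨
      fromℕ T * (1# * (A₀ * A₀) + fromℕ r * (A₀ * A₀))  ≈⟨ *-congˡ (distribʳ (A₀ * A₀) 1# (fromℕ r)) ⟨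
      fromℕ T * (fromℕ (suc r) * (A₀ * A₀))      ≈⟨ *-assoc _ _ _ ⟨
      fromℕ T * fromℕ (suc r) * (A₀ * A₀)        ≈⟨ *-congʳ (×1-homo-* T (suc r)) ⟨
      fromℕ (T ℕ.* suc r) * (A₀ * A₀)            ≡⟨ ≡.cong (λ N → fromℕ N * (A₀ * A₀)) ([2m+1]2^[2m∸1]≡ m) ⟨
      fromℕ N * (A₀ * A₀)                        ≤⟨ N*A₀²≤‖b₀‖² ⟩
      ⟨ b zero , b zero ⟩                        ≤⟨ ‖b₀‖²≤ H x y basis reduced z≢0 ⟩
      fromℕ T * ⟨ v , v ⟩                        ≤⟨ *-monoʳ-≤ (0≤fromℕ T) ‖v‖²≤ ⟩
      fromℕ T * (H * modulus Λ * (H * modulus Λ) + fromℕ r * (A₀ * A₀))  ∎)))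
    where
    ‖v‖²≤ : ⟨ v , v ⟩ ≤ H * modulus Λ * (H * modulus Λ) + fromℕ r * (A₀ * A₀)
    ‖v‖²≤ = begin
      ⟨ v , v ⟩                                     ≈⟨ ‖latticeVector‖² H x y ⟩
      _                                             ≤⟨ +-mono-≤ (sum-≤ z²≤A₀²) ≤-refl ⟩
      fromℕ r * (A₀ * A₀) + H * modulus Λ * (H * modulus Λ)  ≈⟨ +-comm _ _ ⟩
      H * modulus Λ * (H * modulus Λ) + fromℕ r * (A₀ * A₀)  ∎
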